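{- As $n\to\infty$, \[ 2\log s(n,2) \sim \log p(n,2) \sim \log m(n,2). \]
   Context: For integers $0\le r\le n$, $m(n,r)$ denotes the number of matroids of rank $r$ on the fixed ground set $[n]=\{1,\dots,n\}$, $p(n,r)$ the number of those that are paving, and $s(n,r)$ the number of those that are sparse paving. A matroid of rank $r$ is paving if every circuit has cardinality at least $r$; it is sparse paving if both it and its dual are paving (equivalently, every $r$-subset of the ground set is either a basis or a circuit-hyperplane). $\log$ denotes the logarithm to base $2$, and $f\sim g$ means $f/g\to 1$. -}

module Defs where

import Data.Bool.Properties as Bool
open import Data.Empty using () renaming (⊥ to Empty)
open import Data.Fin.Properties using (any?)
open import Data.Fin.Subset using (Subset; inside; outside; _∈_; _∉_; _⊆_; _⊂_; _∪_; ⁅_⁆; ∁; ∣_∣)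
  renaming (⊥ to ∅)
open import Data.Fin.Subset.Properties using (_∈?_; _⊆?_; _⊂?_; anySubset?)
open import Data.Integer.Base as ℤ using (+_; -[1+_])
import Data.Integer.Properties as ℤ
open import Data.List.Base using (List; []; _∷_; _++_; map; filter; length)
import Data.List.Membership.DecPropositional as ListMembership
open import Data.Nat.Base as ℕ using (ℕ; zero; suc)
import Data.Nat.Properties as ℕ
open import Data.Product using (Σ; ∃; _×_; _,_; proj₁; proj₂)
open import Data.Rational.Unnormalised.Base as ℚ using (ℚᵘ; mkℚᵘ; 0ℚᵘ; 1ℚᵘ; *<*; Positive)
import Data.Rational.Unnormalised.Properties as ℚ
open import Data.Rational.Unnormalised.Solver using (module +-*-Solver)
open import Data.Sum using (_⊎_; inj₁; inj₂; [_,_]′)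
open import Data.Unit using (⊤; tt)
open import Data.Vec.Base using ([]; _∷_)
import Data.Vec.Properties as Vec
open import Function using (_∘_)
open import Level using (0ℓ)
open import Relation.Binary.Definitions using (DecidableEquality)
open import Relation.Binary.PropositionalEquality using (_≡_; refl; sym; trans; cong; subst; subst₂)
open import Relation.Nullary using (¬_; Dec; yes; no; ¬?; contradiction)
open import Relation.Nullary.Decidable using (map′; _×-dec_; _→-dec_; decidable-stable)
open import Relation.Unary using (Pred; Decidable)

------------------------------------------------------------------------
-- Matroids on the ground set Fin n, given by their independent sets

record IsMatroid {n : ℕ} (I : Pred (Subset n) 0ℓ) : Set where
  field
    empty        : I ∅
    hereditary   : ∀ A B → A ⊆ B → I B → I A
    augmentation : ∀ A B → I A → I B → ∣ A ∣ ℕ.< ∣ B ∣ →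
                   ∃ λ e → e ∈ B × e ∉ A × I (A ∪ ⁅ e ⁆)

module _ {n : ℕ} (I : Pred (Subset n) 0ℓ) where

  Basis : Pred (Subset n) 0ℓ
  Basis B = I B × (∀ A → I A → B ⊆ A → A ≡ B)

  Circuit : Pred (Subset n) 0ℓ
  Circuit C = ¬ I C × (∀ A → A ⊂ C → I A)

  HasRank : ℕ → Set
  HasRank r = ∃ λ B → Basis B × ∣ B ∣ ≡ r

  Paving : Set
  Paving = ∀ r → HasRank r → ∀ C → Circuit C → r ℕ.≤ ∣ C ∣

-- The bases of the dual are the complements of the bases.
Dual : ∀ {n} → Pred (Subset n) 0ℓ → Pred (Subset n) 0ℓ
Dual I A = ∃ λ B → Basis I B × A ⊆ ∁ B

SparsePaving : ∀ {n} → Pred (Subset n) 0ℓ → Set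
SparsePaving I = Paving I × Paving (Dual I)

infix 4 _≟ˢ_
_≟ˢ_ : ∀ {n} → DecidableEquality (Subset n)
_≟ˢ_ = Vec.≡-dec Bool._≟_

allSubset? : ∀ {n} {P : Pred (Subset n) 0ℓ} → Decidable P → Dec (∀ A → P A)
allSubset? P? = map′
  (λ ¬∃¬P A → decidable-stable (P? A) (λ ¬PA → ¬∃¬P (A , ¬PA)))
  (λ ∀P (A , ¬PA) → ¬PA (∀P A))
  (¬? (anySubset? (¬? ∘ P?)))

module _ {n : ℕ} {I : Pred (Subset n) 0ℓ} (I? : Decidable I) where

  isMatroid? : Dec (IsMatroid I)
  isMatroid? = map′
    (λ (e , h , a) → record { empty = e ; hereditary = h ; augmentation = a })
    (λ m → let open IsMatroid m in empty , hereditary , augmentation)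
    (I? ∅
      ×-dec allSubset? (λ A → allSubset? λ B → (A ⊆? B) →-dec (I? B →-dec I? A))
      ×-dec allSubset? (λ A → allSubset? λ B →
              I? A →-dec (I? B →-dec ((∣ A ∣ ℕ.<? ∣ B ∣) →-dec
              any? λ e → (e ∈? B) ×-dec (¬? (e ∈? A) ×-dec I? (A ∪ ⁅ e ⁆))))))

  basis? : Decidable (Basis I)
  basis? B = I? B ×-dec allSubset? (λ A → I? A →-dec ((B ⊆? A) →-dec (A ≟ˢ B)))

  circuit? : Decidable (Circuit I)
  circuit? C = ¬? (I? C) ×-dec allSubset? (λ A → (A ⊂? C) →-dec I? A)

  hasRank? : ∀ r → Dec (HasRank I r)
  hasRank? r = anySubset? λ B → basis? B ×-dec (∣ B ∣ ℕ.≟ r)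

  paving? : Dec (Paving I)
  paving? = map′
    (λ { h r (B , basis , refl) → h B basis })
    (λ h B basis → h ∣ B ∣ (B , basis , refl))
    (allSubset? λ B → basis? B →-dec allSubset? λ C → circuit? C →-dec (∣ B ∣ ℕ.≤? ∣ C ∣))

  dual? : Decidable (Dual I)
  dual? A = anySubset? λ B → basis? B ×-dec (A ⊆? ∁ B)

sparsePaving? : ∀ {n} {I : Pred (Subset n) 0ℓ} → Decidable I → Dec (SparsePaving I)
sparsePaving? I? = paving? I? ×-dec paving? (dual? I?)

------------------------------------------------------------------------
-- Counting

sublists : ∀ {A : Set} → List A → List (List A)
sublists []       = [] ∷ []
sublists (x ∷ xs) = sublists xs ++ map (x ∷_) (sublists xs)

-- Every subset of Fin n occurs exactly once.
subsets : ∀ n → List (Subset n)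
subsets zero    = [] ∷ []
subsets (suc n) = map (outside ∷_) (subsets n) ++ map (inside ∷_) (subsets n)

-- A set family on Fin n is represented by the list of its members in the order
-- of `subsets n`, so `families n` contains every set family exactly once.
families : ∀ n → List (List (Subset n))
families n = sublists (subsets n)

Member : ∀ {n} → List (Subset n) → Pred (Subset n) 0ℓ
Member F A = A ∈ᴸ F
  where open ListMembership _≟ˢ_ renaming (_∈_ to _∈ᴸ_)

member? : ∀ {n} (F : List (Subset n)) → Decidable (Member F)
member? F A = A ∈ᴸ? F
  where open ListMembership _≟ˢ_ renaming (_∈?_ to _∈ᴸ?_)

MatroidOfRank : ∀ {n} → ℕ → Pred (Subset n) 0ℓ → Set
MatroidOfRank r I = IsMatroid I × HasRank I r

matroidOfRank? : ∀ {n} r {I : Pred (Subset n) 0ℓ} → Decidable I → Dec (MatroidOfRank r I)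
matroidOfRank? r I? = isMatroid? I? ×-dec hasRank? I? r

m : ℕ → ℕ → ℕ
m n r = length (filter (λ F → matroidOfRank? r (member? F)) (families n))

p : ℕ → ℕ → ℕ
p n r = length (filter (λ F → matroidOfRank? r (member? F) ×-dec paving? (member? F)) (families n))

s : ℕ → ℕ → ℕ
s n r = length (filter (λ F → matroidOfRank? r (member? F) ×-dec sparsePaving? (member? F)) (families n))

------------------------------------------------------------------------
-- Real numbers as two-sided Dedekind cuts

record ℝ : Set₁ where
  field
    Lower Upper     : Pred ℚᵘ 0ℓ
    lower-inhabited : ∃ Lower
    upper-inhabited : ∃ Upper
    lower-closed    : ∀ {q r} → q ℚ.< r → Lower r → Lower q
    upper-closed    : ∀ {q r} → q ℚ.< r → Upper q → Upper r
    lower-open      : ∀ {q} → Lower q → ∃ λ r → q ℚ.< r × Lower r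
    upper-open      : ∀ {q} → Upper q → ∃ λ r → r ℚ.< q × Upper r
    disjoint        : ∀ {q} → Lower q → ¬ Upper q
    located         : ∀ {q r} → q ℚ.< r → Lower q ⊎ Upper r

  lower-≤ : ∀ {q r} → q ℚ.≤ r → Lower r → Lower q
  lower-≤ q≤r Lr with lower-open Lr
  ... | _ , r<t , Lt = lower-closed (ℚ.≤-<-trans q≤r r<t) Lt

  upper-≤ : ∀ {q r} → q ℚ.≤ r → Upper q → Upper r
  upper-≤ q≤r Uq with upper-open Uq
  ... | _ , t<q , Ut = upper-closed (ℚ.<-≤-trans t<q q≤r) Ut

  lower<upper : ∀ {q r} → Lower q → Upper r → q ℚ.< r
  lower<upper {q} {r} Lq Ur with q ℚ.<? r
  ... | yes q<r = q<r
  ... | no  q≮r = contradiction Ur (disjoint (lower-≤ (ℚ.≮⇒≥ q≮r) Lq))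

infix 4 _<ʳ_ _ʳ<_

_<ʳ_ : ℚᵘ → ℝ → Set
q <ʳ x = ℝ.Lower x q

_ʳ<_ : ℝ → ℚᵘ → Set
x ʳ< q = ℝ.Upper x q

------------------------------------------------------------------------
-- Positive integer multiples

infixr 7 _·_

_·_ : (k : ℕ) .{{_ : ℕ.NonZero k}} → ℝ → ℝ
k@(suc k-1) · x = record
  { Lower           = λ q → Lower (q ℚ.* 1/k)
  ; Upper           = λ q → Upper (q ℚ.* 1/k)
  ; lower-inhabited = let q , Lq = lower-inhabited in
                      q ℚ.* k/1 , lower-≤ (ℚ.≤-reflexive (cancel q)) Lq
  ; upper-inhabited = let q , Uq = upper-inhabited in
                      q ℚ.* k/1 , upper-≤ (ℚ.≤-reflexive (ℚ.≃-sym (cancel q))) Uq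
  ; lower-closed    = λ q<r → lower-closed (ℚ.*-monoˡ-<-pos 1/k q<r)
  ; upper-closed    = λ q<r → upper-closed (ℚ.*-monoˡ-<-pos 1/k q<r)
  ; lower-open      = λ {q} Lq → let r , q<r , Lr = lower-open Lq in
                      r ℚ.* k/1 ,
                      ℚ.*-cancelʳ-<-nonNeg 1/k (ℚ.<-respʳ-≃ (ℚ.≃-sym (cancel r)) q<r) ,
                      lower-≤ (ℚ.≤-reflexive (cancel r)) Lr
  ; upper-open      = λ {q} Uq → let r , r<q , Ur = upper-open Uq in
                      r ℚ.* k/1 ,
                      ℚ.*-cancelʳ-<-nonNeg 1/k (ℚ.<-respˡ-≃ (ℚ.≃-sym (cancel r)) r<q) ,
                      upper-≤ (ℚ.≤-reflexive (ℚ.≃-sym (cancel r))) Ur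
  ; disjoint        = disjoint
  ; located         = λ q<r → located (ℚ.*-monoˡ-<-pos 1/k q<r)
  }
  where
  open ℝ x

  k/1 1/k : ℚᵘ
  k/1 = + k ℚ./ 1
  1/k = + 1 ℚ./ k

  cancel : ∀ q → q ℚ.* k/1 ℚ.* 1/k ℚ.≃ q
  cancel q = ℚ.≃-trans (ℚ.*-assoc q k/1 1/k)
    (ℚ.≃-trans (ℚ.*-congˡ {q} (ℚ.*-inverseʳ k/1)) (ℚ.*-identityʳ q))

------------------------------------------------------------------------
-- Binary logarithms of positive integers

-- For d > 0, a/d < log₂ N means 2 ^ (a/d) < N, that is, 2 ^ a < N ^ d.  Since
-- N ≥ 1, every negative rational is below log₂ N.

BelowLog AboveLog : ℕ → Pred ℚᵘ 0ℓ

BelowLog N q@(mkℚᵘ (+ a) _)  = 2 ℕ.^ a ℕ.< N ℕ.^ ℚ.↧ₙ q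
BelowLog N (mkℚᵘ -[1+ _ ] _) = ⊤

AboveLog N q@(mkℚᵘ (+ a) _)  = N ℕ.^ ℚ.↧ₙ q ℕ.< 2 ℕ.^ a
AboveLog N (mkℚᵘ -[1+ _ ] _) = Empty

module LogLemmas where
  cross-< : ∀ {a d b e} → mkℚᵘ (+ a) d ℚ.< mkℚᵘ (+ b) e → a ℕ.* suc e ℕ.< b ℕ.* suc d
  cross-< {a} {d} {b} {e} (*<* lt) =
    ℤ.drop‿+<+ (subst₂ ℤ._<_ (sym (ℤ.pos-* a (suc e))) (sym (ℤ.pos-* b (suc d))) lt)

  uncross-< : ∀ {a d b e} → a ℕ.* suc e ℕ.< b ℕ.* suc d → mkℚᵘ (+ a) d ℚ.< mkℚᵘ (+ b) e
  uncross-< {a} {d} {b} {e} lt =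
    *<* (subst₂ ℤ._<_ (ℤ.pos-* a (suc e)) (ℤ.pos-* b (suc d)) (ℤ.+<+ lt))

  ^-cancelˡ-< : ∀ x y e → x ℕ.^ e ℕ.< y ℕ.^ e → x ℕ.< y
  ^-cancelˡ-< x y e lt = ℕ.≰⇒> (λ y≤x → ℕ.<⇒≱ lt (ℕ.^-monoˡ-≤ e y≤x))

  ^-swap : ∀ x a b → (x ℕ.^ a) ℕ.^ b ≡ (x ℕ.^ b) ℕ.^ a
  ^-swap x a b = trans (ℕ.^-*-assoc x a b)
    (trans (cong (x ℕ.^_) (ℕ.*-comm a b)) (sym (ℕ.^-*-assoc x b a)))

  below-mono : ∀ N a d b e → .{{ℕ.NonZero d}} → a ℕ.* e ℕ.≤ b ℕ.* d →
               2 ℕ.^ b ℕ.< N ℕ.^ e → 2 ℕ.^ a ℕ.< N ℕ.^ d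
  below-mono N a d b e ae≤bd lt = ^-cancelˡ-< (2 ℕ.^ a) (N ℕ.^ d) e (begin-strict
    (2 ℕ.^ a) ℕ.^ e  ≡⟨ ℕ.^-*-assoc 2 a e ⟩
    2 ℕ.^ (a ℕ.* e)  ≤⟨ ℕ.^-monoʳ-≤ 2 ae≤bd ⟩
    2 ℕ.^ (b ℕ.* d)  ≡⟨ ℕ.^-*-assoc 2 b d ⟨
    (2 ℕ.^ b) ℕ.^ d  <⟨ ℕ.^-monoˡ-< d lt ⟩
    (N ℕ.^ e) ℕ.^ d  ≡⟨ ^-swap N e d ⟩
    (N ℕ.^ d) ℕ.^ e  ∎)
    where open ℕ.≤-Reasoning

  above-mono : ∀ N a d b e → .{{ℕ.NonZero e}} → a ℕ.* e ℕ.≤ b ℕ.* d →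
               N ℕ.^ d ℕ.< 2 ℕ.^ a → N ℕ.^ e ℕ.< 2 ℕ.^ b
  above-mono N a d b e ae≤bd lt = ^-cancelˡ-< (N ℕ.^ e) (2 ℕ.^ b) d (begin-strict
    (N ℕ.^ e) ℕ.^ d  ≡⟨ ^-swap N e d ⟩
    (N ℕ.^ d) ℕ.^ e  <⟨ ℕ.^-monoˡ-< e lt ⟩
    (2 ℕ.^ a) ℕ.^ e  ≡⟨ ℕ.^-*-assoc 2 a e ⟩
    2 ℕ.^ (a ℕ.* e)  ≤⟨ ℕ.^-monoʳ-≤ 2 ae≤bd ⟩
    2 ℕ.^ (b ℕ.* d)  ≡⟨ ℕ.^-*-assoc 2 b d ⟨
    (2 ℕ.^ b) ℕ.^ d  ∎)
    where open ℕ.≤-Reasoning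

  bernoulli : ∀ x k → x ℕ.^ suc k ℕ.+ suc k ℕ.* x ℕ.^ k ℕ.≤ suc x ℕ.^ suc k
  bernoulli x zero    = ℕ.≤-reflexive (trans (ℕ.+-comm (x ℕ.* 1) 1) refl)
  bernoulli x (suc k) = begin
    x ℕ.* y ℕ.+ (y ℕ.+ suc k ℕ.* y)                ≡⟨ cong (λ z → x ℕ.* y ℕ.+ (y ℕ.+ z)) eq ⟩
    x ℕ.* y ℕ.+ (y ℕ.+ x ℕ.* z)                    ≡⟨ ℕ.+-assoc (x ℕ.* y) y (x ℕ.* z) ⟨
    x ℕ.* y ℕ.+ y ℕ.+ x ℕ.* z                      ≡⟨ cong (ℕ._+ x ℕ.* z) (ℕ.+-comm (x ℕ.* y) y) ⟩
    y ℕ.+ x ℕ.* y ℕ.+ x ℕ.* z                      ≡⟨ ℕ.+-assoc y (x ℕ.* y) (x ℕ.* z) ⟩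
    y ℕ.+ (x ℕ.* y ℕ.+ x ℕ.* z)                    ≡⟨ cong (y ℕ.+_) (ℕ.*-distribˡ-+ x y z) ⟨
    y ℕ.+ x ℕ.* (y ℕ.+ z)                          ≤⟨ ℕ.+-monoˡ-≤ _ (ℕ.m≤m+n y z) ⟩
    suc x ℕ.* (y ℕ.+ z)                            ≤⟨ ℕ.*-monoʳ-≤ (suc x) (bernoulli x k) ⟩
    suc x ℕ.* suc x ℕ.^ suc k                      ∎
    where
    open ℕ.≤-Reasoning
    y z : ℕ
    y = x ℕ.^ suc k
    z = suc k ℕ.* x ℕ.^ k
    eq : suc k ℕ.* y ≡ x ℕ.* z
    eq = trans (sym (ℕ.*-assoc (suc k) x (x ℕ.^ k)))
      (trans (cong (ℕ._* x ℕ.^ k) (ℕ.*-comm (suc k) x)) (ℕ.*-assoc x (suc k) (x ℕ.^ k)))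

  double : ∀ {x y} → .{{ℕ.NonZero x}} → x ℕ.< y → 2 ℕ.* x ℕ.^ suc x ℕ.< y ℕ.^ suc x
  double {x} {y} x<y = begin-strict
    2 ℕ.* x ℕ.^ suc x                        ≡⟨ cong (x ℕ.^ suc x ℕ.+_) (ℕ.+-identityʳ _) ⟩
    x ℕ.^ suc x ℕ.+ x ℕ.* x ℕ.^ x            <⟨ ℕ.+-monoʳ-< (x ℕ.^ suc x) (ℕ.*-monoˡ-< (x ℕ.^ x) {{ℕ.m^n≢0 x x}} (ℕ.n<1+n x)) ⟩
    x ℕ.^ suc x ℕ.+ suc x ℕ.* x ℕ.^ x        ≤⟨ bernoulli x x ⟩
    suc x ℕ.^ suc x                          ≤⟨ ℕ.^-monoˡ-≤ (suc x) x<y ⟩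
    y ℕ.^ suc x                              ∎
    where open ℕ.≤-Reasoning

  n<2^n : ∀ n → n ℕ.< 2 ℕ.^ n
  n<2^n zero    = ℕ.z<s
  n<2^n (suc n) = begin-strict
    1 ℕ.+ n                <⟨ ℕ.+-mono-≤-< (ℕ.m^n>0 2 n) (n<2^n n) ⟩
    2 ℕ.^ n ℕ.+ 2 ℕ.^ n    ≡⟨ cong (2 ℕ.^ n ℕ.+_) (ℕ.+-identityʳ _) ⟨
    2 ℕ.^ suc n            ∎
    where open ℕ.≤-Reasoning

  module Log (N : ℕ) .{{_ : ℕ.NonZero N}} where

    lower-closed : ∀ {q r} → q ℚ.< r → BelowLog N r → BelowLog N q
    lower-closed {mkℚᵘ -[1+ _ ] _} {_}              _   _  = tt
    lower-closed {mkℚᵘ (+ a) d}    {mkℚᵘ (+ b) e}   q<r lt =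
      below-mono N a (suc d) b (suc e) (ℕ.<⇒≤ (cross-< q<r)) lt
    lower-closed {mkℚᵘ (+ zero) d} {mkℚᵘ -[1+ _ ] e} (*<* ()) _
    lower-closed {mkℚᵘ (+ suc _) d} {mkℚᵘ -[1+ _ ] e} (*<* ()) _

    upper-closed : ∀ {q r} → q ℚ.< r → AboveLog N q → AboveLog N r
    upper-closed {mkℚᵘ (+ a) d}    {mkℚᵘ (+ b) e}   q<r lt =
      above-mono N a (suc d) b (suc e) (ℕ.<⇒≤ (cross-< q<r)) lt
    upper-closed {mkℚᵘ (+ zero) d} {mkℚᵘ -[1+ _ ] e} (*<* ()) _
    upper-closed {mkℚᵘ (+ suc _) d} {mkℚᵘ -[1+ _ ] e} (*<* ()) _

    lower-open : ∀ {q} → BelowLog N q → ∃ λ r → q ℚ.< r × BelowLog N r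
    lower-open {mkℚᵘ -[1+ a ] d} _ =
      mkℚᵘ -[1+ a ] (suc d) , *<* (ℤ.*-monoˡ-<-neg -[1+ a ] (ℤ.+<+ (ℕ.n<1+n (suc d)))) , tt
    lower-open {mkℚᵘ (+ a) d} lt =
      + suc (a ℕ.* K) ℚ./ (suc d ℕ.* K) ,
      uncross-< (begin-strict
        a ℕ.* (suc d ℕ.* K)          ≡⟨ cong (a ℕ.*_) (ℕ.*-comm (suc d) K) ⟩
        a ℕ.* (K ℕ.* suc d)          ≡⟨ ℕ.*-assoc a K (suc d) ⟨
        a ℕ.* K ℕ.* suc d            <⟨ ℕ.*-monoˡ-< (suc d) (ℕ.n<1+n (a ℕ.* K)) ⟩
        suc (a ℕ.* K) ℕ.* suc d      ∎) ,
      (begin-strict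
        2 ℕ.* 2 ℕ.^ (a ℕ.* K)        ≡⟨ cong (2 ℕ.*_) (ℕ.^-*-assoc 2 a K) ⟨
        2 ℕ.* (2 ℕ.^ a) ℕ.^ K        <⟨ double {{ℕ.m^n≢0 2 a}} lt ⟩
        (N ℕ.^ suc d) ℕ.^ K          ≡⟨ ℕ.^-*-assoc N (suc d) K ⟩
        N ℕ.^ (suc d ℕ.* K)          ∎)
      where
      open ℕ.≤-Reasoning
      K : ℕ
      K = suc (2 ℕ.^ a)

    upper-open : ∀ {q} → AboveLog N q → ∃ λ r → r ℚ.< q × AboveLog N r
    upper-open {mkℚᵘ (+ zero) d} lt = contradiction lt (ℕ.≤⇒≯ (ℕ.m^n>0 N (suc d)))
    upper-open {mkℚᵘ (+ suc a) d} lt =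
      + c ℚ./ (suc d ℕ.* K) ,
      uncross-< (begin-strict
        c ℕ.* suc d                  <⟨ ℕ.*-monoˡ-< (suc d) (ℕ.n<1+n c) ⟩
        suc a ℕ.* K ℕ.* suc d        ≡⟨ ℕ.*-assoc (suc a) K (suc d) ⟩
        suc a ℕ.* (K ℕ.* suc d)      ≡⟨ cong (suc a ℕ.*_) (ℕ.*-comm K (suc d)) ⟩
        suc a ℕ.* (suc d ℕ.* K)      ∎) ,
      ℕ.*-cancelˡ-< 2 _ _ (begin-strict
        2 ℕ.* N ℕ.^ (suc d ℕ.* K)    ≡⟨ cong (2 ℕ.*_) (ℕ.^-*-assoc N (suc d) K) ⟨
        2 ℕ.* (N ℕ.^ suc d) ℕ.^ K    <⟨ double {{ℕ.m^n≢0 N (suc d)}} lt ⟩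
        (2 ℕ.^ suc a) ℕ.^ K          ≡⟨ ℕ.^-*-assoc 2 (suc a) K ⟩
        2 ℕ.^ (suc a ℕ.* K)          ∎)
      where
      open ℕ.≤-Reasoning
      K c : ℕ
      K = suc (N ℕ.^ suc d)
      c = N ℕ.^ suc d ℕ.+ a ℕ.* K

    disjoint : ∀ {q} → BelowLog N q → ¬ AboveLog N q
    disjoint {mkℚᵘ (+ _) _}    lt gt = ℕ.<-asym lt gt
    disjoint {mkℚᵘ -[1+ _ ] _} _  ()

    located : ∀ {q r} → q ℚ.< r → BelowLog N q ⊎ AboveLog N r
    located {mkℚᵘ -[1+ _ ] _} _ = inj₁ tt
    located {mkℚᵘ (+ zero) d} {mkℚᵘ -[1+ _ ] e} (*<* ())
    located {mkℚᵘ (+ suc _) d} {mkℚᵘ -[1+ _ ] e} (*<* ())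
    located {mkℚᵘ (+ a) d} {mkℚᵘ (+ b) e} q<r with 2 ℕ.^ a ℕ.<? N ℕ.^ suc d
    ... | yes lt  = inj₁ lt
    ... | no  nlt = inj₂ (^-cancelˡ-< _ _ (suc d) (begin-strict
      (N ℕ.^ suc e) ℕ.^ suc d  ≡⟨ ^-swap N (suc e) (suc d) ⟩
      (N ℕ.^ suc d) ℕ.^ suc e  ≤⟨ ℕ.^-monoˡ-≤ (suc e) (ℕ.≮⇒≥ nlt) ⟩
      (2 ℕ.^ a) ℕ.^ suc e      ≡⟨ ℕ.^-*-assoc 2 a (suc e) ⟩
      2 ℕ.^ (a ℕ.* suc e)      <⟨ ℕ.^-monoʳ-< 2 (ℕ.n<1+n 1) (cross-< q<r) ⟩
      2 ℕ.^ (b ℕ.* suc d)      ≡⟨ ℕ.^-*-assoc 2 b (suc d) ⟨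
      (2 ℕ.^ b) ℕ.^ suc d      ∎))
      where open ℕ.≤-Reasoning

open LogLemmas

log₂⁺ : (N : ℕ) .{{_ : ℕ.NonZero N}} → ℝ
log₂⁺ N = record
  { Lower           = BelowLog N
  ; Upper           = AboveLog N
  ; lower-inhabited = mkℚᵘ -[1+ 0 ] 0 , tt
  ; upper-inhabited = mkℚᵘ (+ N) 0 , subst (ℕ._< 2 ℕ.^ N) (sym (ℕ.^-identityʳ N)) (n<2^n N)
  ; Log N
  }

-- The value at 0 is a dummy; m n r, p n r and s n r are positive when r ≤ n.
log₂ : ℕ → ℝ
log₂ zero      = log₂⁺ 1
log₂ N@(suc _) = log₂⁺ N

------------------------------------------------------------------------
-- Quotients by positive reals

module QuotientLemmas where
  max-below : ∀ s t a b → .{{Positive s}} → .{{Positive t}} → ∃ λ r →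
              r ℚ.* s ℚ.≤ a × r ℚ.* t ℚ.≤ b ×
              (∀ q → q ℚ.* s ℚ.< a → q ℚ.* t ℚ.< b → q ℚ.< r)
  max-below s t a b = pick (ℚ.≤-total a/s b/t)
    where
    instance
      _ = ℚ.pos⇒nonZero s
      _ = ℚ.pos⇒nonZero t
      _ = ℚ.pos⇒nonNeg s
      _ = ℚ.pos⇒nonNeg t
    a/s b/t : ℚᵘ
    a/s = a ℚ.* ℚ.1/ s
    b/t = b ℚ.* ℚ.1/ t
    cancel : ∀ x u .{{_ : ℚ.NonZero u}} → x ℚ.* ℚ.1/ u ℚ.* u ℚ.≃ x
    cancel x u = ℚ.≃-trans (ℚ.*-assoc x (ℚ.1/ u) u)
      (ℚ.≃-trans (ℚ.*-congˡ {x} (ℚ.*-inverseˡ u)) (ℚ.*-identityʳ x))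
    pick : a/s ℚ.≤ b/t ⊎ b/t ℚ.≤ a/s → _
    pick (inj₁ le) = a/s , ℚ.≤-reflexive (cancel a s) ,
      ℚ.≤-trans (ℚ.*-monoˡ-≤-nonNeg t le) (ℚ.≤-reflexive (cancel b t)) ,
      λ q qs<a _ → ℚ.*-cancelʳ-<-nonNeg s (ℚ.<-respʳ-≃ (ℚ.≃-sym (cancel a s)) qs<a)
    pick (inj₂ le) = b/t ,
      ℚ.≤-trans (ℚ.*-monoˡ-≤-nonNeg s le) (ℚ.≤-reflexive (cancel a s)) ,
      ℚ.≤-reflexive (cancel b t) ,
      λ q _ qt<b → ℚ.*-cancelʳ-<-nonNeg t (ℚ.<-respʳ-≃ (ℚ.≃-sym (cancel b t)) qt<b)

  min-above : ∀ s t a b → .{{Positive s}} → .{{Positive t}} → ∃ λ r →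
              a ℚ.≤ r ℚ.* s × b ℚ.≤ r ℚ.* t ×
              (∀ q → a ℚ.< q ℚ.* s → b ℚ.< q ℚ.* t → r ℚ.< q)
  min-above s t a b with max-below s t (ℚ.- a) (ℚ.- b)
  ... | r , rs≤-a , rt≤-b , greatest =
    ℚ.- r , flip-≤ s rs≤-a , flip-≤ t rt≤-b ,
    λ q a<qs b<qt → subst (ℚ.- r ℚ.<_) (ℚ.neg-involutive-≡ q)
      (ℚ.neg-mono-< (greatest (ℚ.- q) (flip-< q s a<qs) (flip-< q t b<qt)))
    where
    flip-≤ : ∀ {c} u → r ℚ.* u ℚ.≤ ℚ.- c → c ℚ.≤ (ℚ.- r) ℚ.* u
    flip-≤ {c} u le = ℚ.≤-respʳ-≃ (ℚ.neg-distribˡ-* r u)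
      (subst (ℚ._≤ ℚ.- (r ℚ.* u)) (ℚ.neg-involutive-≡ c) (ℚ.neg-mono-≤ le))
    flip-< : ∀ {c} q u → c ℚ.< q ℚ.* u → (ℚ.- q) ℚ.* u ℚ.< ℚ.- c
    flip-< q u lt = ℚ.<-respˡ-≃ (ℚ.neg-distribˡ-* q u) (ℚ.neg-mono-< lt)

  archimedean : ∀ x δ → .{{Positive δ}} → ∃ λ K → x ℚ.≤ (+ K ℚ./ 1) ℚ.* δ
  archimedean x@(mkℚᵘ -[1+ _ ] _) δ@(mkℚᵘ (+ suc _) _) = 0 , ℚ.≤-trans
    (ℚ.<⇒≤ (ℚ.negative⁻¹ x)) (ℚ.≤-reflexive (ℚ.≃-sym (ℚ.*-zeroˡ δ)))
  archimedean (mkℚᵘ (+ a) d) δ@(mkℚᵘ (+ suc b) e) = a ℕ.* suc e ,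
    ℚ.*≤* (subst₂ ℤ._≤_ (ℤ.pos-* a _)
      (trans (ℤ.pos-* (a ℕ.* suc e ℕ.* suc b) (suc d)) (cong (ℤ._* + suc d) (ℤ.pos-* (a ℕ.* suc e) (suc b))))
      (ℤ.+≤+ bound))
    where
    open ℕ.≤-Reasoning
    bound : a ℕ.* suc (e ℕ.+ 0) ℕ.≤ a ℕ.* suc e ℕ.* suc b ℕ.* suc d
    bound = begin
      a ℕ.* suc (e ℕ.+ 0)                ≡⟨ cong (λ z → a ℕ.* suc z) (ℕ.+-identityʳ e) ⟩
      a ℕ.* suc e                        ≤⟨ ℕ.m≤m*n _ (suc b) ⟩
      a ℕ.* suc e ℕ.* suc b              ≤⟨ ℕ.m≤m*n _ (suc d) ⟩
      a ℕ.* suc e ℕ.* suc b ℕ.* suc d    ∎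

  x≤∣x∣ : ∀ x → x ℚ.≤ ℚ.∣ x ∣
  x≤∣x∣ x@(mkℚᵘ (+ _) _)    = ℚ.≤-refl
  x≤∣x∣ x@(mkℚᵘ -[1+ _ ] _) = ℚ.≤-trans (ℚ.<⇒≤ (ℚ.negative⁻¹ x)) (ℚ.0≤∣p∣ x)

  <⇒0<- : ∀ {x y} → x ℚ.< y → 0ℚᵘ ℚ.< y ℚ.- x
  <⇒0<- {x} {y} x<y = ℚ.<-respˡ-≃ (ℚ.+-inverseʳ x) (ℚ.+-monoˡ-< (ℚ.- x) x<y)

  module Ring where
    open +-*-Solver

    next : ∀ a d k → a ℚ.+ (1ℚᵘ ℚ.+ k) ℚ.* d ℚ.≃ a ℚ.+ d ℚ.+ k ℚ.* d
    next = solve 3 (λ a d k → a :+ (con 1ℚᵘ :+ k) :* d := a :+ d :+ k :* d) ℚ.≃-refl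

    add-sub : ∀ a u → a ℚ.+ (u ℚ.- a) ℚ.≃ u
    add-sub = solve 2 (λ a u → a :+ (u :+ :- a) := u) ℚ.≃-refl

    swap : ∀ b g i → b ℚ.* (g ℚ.* i) ℚ.≃ g ℚ.* (b ℚ.* i)
    swap = solve 3 (λ b g i → b :* (g :* i) := g :* (b :* i)) ℚ.≃-refl

    halves : ∀ s e → s ℚ.+ e ℚ.* ℚ.½ ℚ.+ e ℚ.* ℚ.½ ℚ.- s ℚ.≃ e
    halves s e = ℚ.≃-trans
      (solve 3 (λ s e h → s :+ e :* h :+ e :* h :+ :- s := e :* (h :+ h)) ℚ.≃-refl s e ℚ.½)
      (ℚ.≃-trans (ℚ.*-congˡ {e} (ℚ.*≡* refl)) (ℚ.*-identityʳ e))

    shift : ∀ q s t → q ℚ.* s ℚ.+ q ℚ.* (t ℚ.- s) ℚ.≃ q ℚ.* t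
    shift = solve 3 (λ q s t → q :* s :+ q :* (t :+ :- s) := q :* t) ℚ.≃-refl

    gapˢ : ∀ q r s → q ℚ.* s ℚ.+ (r ℚ.- q) ℚ.* s ℚ.≃ r ℚ.* s
    gapˢ = solve 3 (λ q r s → q :* s :+ (r :+ :- q) :* s := r :* s) ℚ.≃-refl

    undo : ∀ q r s t → q ℚ.* s ℚ.+ r ℚ.* (t ℚ.- s) ℚ.+ (ℚ.- r) ℚ.* (t ℚ.- s) ℚ.≃ q ℚ.* s
    undo = solve 4 (λ q r s t → q :* s :+ r :* (t :+ :- s) :+ (:- r) :* (t :+ :- s) := q :* s) ℚ.≃-refl

    gapᵗ : ∀ q r s t → q ℚ.* s ℚ.+ r ℚ.* (t ℚ.- s) ℚ.+ (r ℚ.- q) ℚ.* s ℚ.≃ r ℚ.* t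
    gapᵗ = solve 4 (λ q r s t → q :* s :+ r :* (t :+ :- s) :+ (r :+ :- q) :* s := r :* t) ℚ.≃-refl

  module Approximation (y : ℝ) (δ : ℚᵘ) .{{_ : Positive δ}} where
    open ℝ y

    Close : ℚᵘ → Set
    Close a = ∃ λ s → ∃ λ t → a ℚ.≤ s × Lower s × Upper t × t ℚ.≤ s ℚ.+ δ ℚ.+ δ

    x<x+δ : ∀ x → x ℚ.< x ℚ.+ δ
    x<x+δ x = ℚ.<-respˡ-≃ (ℚ.+-identityʳ x) (ℚ.+-monoʳ-< x (ℚ.positive⁻¹ δ))

    step : ∀ K a → a ℚ.+ (+ suc K ℚ./ 1) ℚ.* δ ℚ.≃ a ℚ.+ δ ℚ.+ (+ K ℚ./ 1) ℚ.* δ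
    step K a = ℚ.≃-trans (ℚ.+-congʳ a (ℚ.*-congʳ {δ} split))
      (Ring.next a δ (+ K ℚ./ 1))
      where
      split : + suc K ℚ./ 1 ℚ.≃ 1ℚᵘ ℚ.+ (+ K ℚ./ 1)
      split = ℚ.*≡* (cong (λ z → (+ 1 ℤ.+ z) ℤ.* + 1) (sym (ℤ.*-identityʳ (+ K))))

    walk : ∀ K {a u} → Lower a → Upper u → u ℚ.≤ a ℚ.+ (+ K ℚ./ 1) ℚ.* δ → Close a
    walk zero {a} La Uu u≤a = contradiction
      (ℚ.≤-respʳ-≃ (ℚ.≃-trans (ℚ.+-congʳ a (ℚ.*-zeroˡ δ)) (ℚ.+-identityʳ a)) u≤a)
      (ℚ.<⇒≱ (lower<upper La Uu))
    walk (suc K) {a} {u} La Uu u≤ = next (located (x<x+δ (a ℚ.+ δ)))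
      where
      u≤′ : u ℚ.≤ a ℚ.+ δ ℚ.+ (+ K ℚ./ 1) ℚ.* δ
      u≤′ = ℚ.≤-respʳ-≃ (step K a) u≤

      next : Lower (a ℚ.+ δ) ⊎ Upper (a ℚ.+ δ ℚ.+ δ) → Close a
      next (inj₂ U) = a , a ℚ.+ δ ℚ.+ δ , ℚ.≤-refl , La , U , ℚ.≤-refl
      next (inj₁ L) =
        let s , t , a+δ≤s , rest = walk K L Uu u≤′
        in s , t , ℚ.≤-trans (ℚ.<⇒≤ (x<x+δ a)) a+δ≤s , rest

    close : ∀ {a} → Lower a → Close a
    close {a} La =
      let u , Uu = upper-inhabited
          K , u-a≤Kδ = archimedean (u ℚ.- a) δ
      in walk K La Uu (ℚ.≤-respˡ-≃
           (Ring.add-sub a u) (ℚ.+-monoʳ-≤ a u-a≤Kδ))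

open QuotientLemmas

module Quotient (x y : ℝ) (y>0 : 0ℚᵘ <ʳ y) where
  private
    module X = ℝ x
    module Y = ℝ y

  -- As y > 0, q < x / y holds iff q * y < x.  For a rational bound s ≤ y ≤ t,
  -- q * y lies between q * s and q * t, in an order given by the sign of q.
  Lower Upper : Pred ℚᵘ 0ℓ
  Lower q = ∃ λ s → ∃ λ t → 0ℚᵘ ℚ.< s × s <ʳ y × y ʳ< t × q ℚ.* s <ʳ x × q ℚ.* t <ʳ x
  Upper q = ∃ λ s → ∃ λ t → 0ℚᵘ ℚ.< s × s <ʳ y × y ʳ< t × x ʳ< q ℚ.* s × x ʳ< q ℚ.* t

  lower-bound : ∃ λ s → 0ℚᵘ ℚ.< s × s <ʳ y
  lower-bound = Y.lower-open y>0

  upper-pos : ∀ {t} → y ʳ< t → 0ℚᵘ ℚ.< t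
  upper-pos = Y.lower<upper y>0

  lower-inhabited : ∃ Lower
  lower-inhabited =
    let s , 0<s , Ls = lower-bound
        t , Ut = Y.upper-inhabited
        a , La = X.lower-inhabited
        r , rs≤a , rt≤a , _ = max-below s t a a {{ℚ.positive 0<s}} {{ℚ.positive (upper-pos Ut)}}
    in r , s , t , 0<s , Ls , Ut , X.lower-≤ rs≤a La , X.lower-≤ rt≤a La

  upper-inhabited : ∃ Upper
  upper-inhabited =
    let s , 0<s , Ls = lower-bound
        t , Ut = Y.upper-inhabited
        a , Ua = X.upper-inhabited
        r , a≤rs , a≤rt , _ = min-above s t a a {{ℚ.positive 0<s}} {{ℚ.positive (upper-pos Ut)}}
    in r , s , t , 0<s , Ls , Ut , X.upper-≤ a≤rs Ua , X.upper-≤ a≤rt Ua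

  lower-closed : ∀ {q r} → q ℚ.< r → Lower r → Lower q
  lower-closed q<r (s , t , 0<s , Ls , Ut , rs , rt) =
    s , t , 0<s , Ls , Ut ,
    X.lower-closed (ℚ.*-monoˡ-<-pos s {{ℚ.positive 0<s}} q<r) rs ,
    X.lower-closed (ℚ.*-monoˡ-<-pos t {{ℚ.positive (upper-pos Ut)}} q<r) rt

  upper-closed : ∀ {q r} → q ℚ.< r → Upper q → Upper r
  upper-closed q<r (s , t , 0<s , Ls , Ut , qs , qt) =
    s , t , 0<s , Ls , Ut ,
    X.upper-closed (ℚ.*-monoˡ-<-pos s {{ℚ.positive 0<s}} q<r) qs ,
    X.upper-closed (ℚ.*-monoˡ-<-pos t {{ℚ.positive (upper-pos Ut)}} q<r) qt

  lower-open : ∀ {q} → Lower q → ∃ λ r → q ℚ.< r × Lower r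
  lower-open {q} (s , t , 0<s , Ls , Ut , qs , qt) =
    let a , qs<a , La = X.lower-open qs
        b , qt<b , Lb = X.lower-open qt
        r , rs≤a , rt≤b , greatest = max-below s t a b {{ℚ.positive 0<s}} {{ℚ.positive (upper-pos Ut)}}
    in r , greatest q qs<a qt<b , s , t , 0<s , Ls , Ut , X.lower-≤ rs≤a La , X.lower-≤ rt≤b Lb

  upper-open : ∀ {q} → Upper q → ∃ λ r → r ℚ.< q × Upper r
  upper-open {q} (s , t , 0<s , Ls , Ut , qs , qt) =
    let a , a<qs , Ua = X.upper-open qs
        b , b<qt , Ub = X.upper-open qt
        r , a≤rs , b≤rt , least = min-above s t a b {{ℚ.positive 0<s}} {{ℚ.positive (upper-pos Ut)}}
    in r , least q a<qs b<qt , s , t , 0<s , Ls , Ut , X.upper-≤ a≤rs Ua , X.upper-≤ b≤rt Ub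

  disjoint : ∀ {q} → Lower q → ¬ Upper q
  disjoint {q} (s , t , _ , Ls , Ut , qs , qt) (s′ , t′ , _ , Ls′ , Ut′ , qs′ , qt′)
    with ℚ.≤-total 0ℚᵘ q
  ... | inj₁ 0≤q = ℚ.<⇒≱ (X.lower<upper qt qs′)
                     (ℚ.*-monoʳ-≤-nonNeg q {{ℚ.nonNegative 0≤q}} (ℚ.<⇒≤ (Y.lower<upper Ls′ Ut)))
  ... | inj₂ q≤0 = ℚ.<⇒≱ (X.lower<upper qs qt′)
                     (ℚ.*-monoʳ-≤-nonPos q {{ℚ.nonPositive q≤0}} (ℚ.<⇒≤ (Y.lower<upper Ls Ut′)))

  located : ∀ {q r} → q ℚ.< r → Lower q ⊎ Upper r
  located {q} {r} q<r =
    decide (Approximation.close y δ {{δ>0}} Ls₀)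
    where
    s₀ : ℚᵘ
    s₀ = proj₁ lower-bound
    0<s₀ : 0ℚᵘ ℚ.< s₀
    0<s₀ = proj₁ (proj₂ lower-bound)
    Ls₀ : s₀ <ʳ y
    Ls₀ = proj₂ (proj₂ lower-bound)

    A B gap η δ : ℚᵘ
    A = ℚ.∣ q ∣ ℚ.+ ℚ.∣ r ∣
    B = A ℚ.+ 1ℚᵘ
    gap = (r ℚ.- q) ℚ.* s₀

    0≤A : 0ℚᵘ ℚ.≤ A
    0≤A = ℚ.≤-respˡ-≃ (ℚ.+-identityʳ 0ℚᵘ) (ℚ.+-mono-≤ (ℚ.0≤∣p∣ q) (ℚ.0≤∣p∣ r))
    A<B : A ℚ.< B
    A<B = ℚ.<-respˡ-≃ (ℚ.+-identityʳ A) (ℚ.+-monoʳ-< A (ℚ.positive⁻¹ 1ℚᵘ))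
    instance
      B>0 : Positive B
      B>0 = ℚ.positive (ℚ.≤-<-trans 0≤A A<B)
      B≢0 : ℚ.NonZero B
      B≢0 = ℚ.pos⇒nonZero B
      r-q>0 : Positive (r ℚ.- q)
      r-q>0 = ℚ.positive (<⇒0<- q<r)
    η = gap ℚ.* ℚ.1/ B
    δ = η ℚ.* ℚ.½
    η>0 : Positive η
    η>0 = ℚ.pos*pos⇒pos gap {{ℚ.pos*pos⇒pos (r ℚ.- q) s₀ {{ℚ.positive 0<s₀}}}} (ℚ.1/ B) {{ℚ.1/pos⇒pos B}}
    δ>0 : Positive δ
    δ>0 = ℚ.pos*pos⇒pos η {{η>0}} ℚ.½

    Bη≃gap : B ℚ.* η ℚ.≃ gap
    Bη≃gap = ℚ.≃-trans (Ring.swap B gap (ℚ.1/ B))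
      (ℚ.≃-trans (ℚ.*-congˡ {gap} (ℚ.*-inverseʳ B)) (ℚ.*-identityʳ gap))

    decide : Approximation.Close y δ {{δ>0}} s₀ → Lower q ⊎ Upper r
    decide (s , t , s₀≤s , Ls , Ut , t≤) = compare (ℚ.≤-total (q ℚ.* s) (q ℚ.* t)) (ℚ.≤-total (r ℚ.* s) (r ℚ.* t))
      where
      0<s : 0ℚᵘ ℚ.< s
      0<s = ℚ.<-≤-trans 0<s₀ s₀≤s
      instance
        s>0 : Positive s
        s>0 = ℚ.positive 0<s
        t>0 : Positive t
        t>0 = ℚ.positive (upper-pos Ut)
      t-s≤η : t ℚ.- s ℚ.≤ η
      t-s≤η = ℚ.≤-respʳ-≃
        (Ring.halves s η)
        (ℚ.+-monoˡ-≤ (ℚ.- s) t≤)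

      small : ∀ c → c ℚ.≤ A → c ℚ.* (t ℚ.- s) ℚ.< (r ℚ.- q) ℚ.* s
      small c c≤A = begin-strict
        c ℚ.* (t ℚ.- s)   ≤⟨ ℚ.*-monoˡ-≤-nonNeg (t ℚ.- s) {{ℚ.nonNegative (ℚ.<⇒≤ (<⇒0<- (Y.lower<upper Ls Ut)))}} c≤A ⟩
        A ℚ.* (t ℚ.- s)   ≤⟨ ℚ.*-monoʳ-≤-nonNeg A {{ℚ.nonNegative 0≤A}} t-s≤η ⟩
        A ℚ.* η           <⟨ ℚ.*-monoˡ-<-pos η {{η>0}} A<B ⟩
        B ℚ.* η           ≃⟨ Bη≃gap ⟩
        (r ℚ.- q) ℚ.* s₀  ≤⟨ ℚ.*-monoʳ-≤-nonNeg (r ℚ.- q) {{ℚ.pos⇒nonNeg (r ℚ.- q)}} s₀≤s ⟩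
        (r ℚ.- q) ℚ.* s   ∎
        where open ℚ.≤-Reasoning

      q≤A : q ℚ.≤ A
      q≤A = ℚ.≤-trans (x≤∣x∣ q) (ℚ.≤-respˡ-≃ (ℚ.+-identityʳ ℚ.∣ q ∣) (ℚ.+-monoʳ-≤ ℚ.∣ q ∣ (ℚ.0≤∣p∣ r)))
      -r≤A : ℚ.- r ℚ.≤ A
      -r≤A = ℚ.≤-trans (subst (ℚ.- r ℚ.≤_) (ℚ.∣-p∣≡∣p∣ r) (x≤∣x∣ (ℚ.- r)))
        (ℚ.≤-respˡ-≃ (ℚ.+-identityˡ ℚ.∣ r ∣) (ℚ.+-monoˡ-≤ ℚ.∣ r ∣ (ℚ.0≤∣p∣ q)))

      qs<rs : q ℚ.* s ℚ.< r ℚ.* s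
      qs<rs = ℚ.*-monoˡ-<-pos s q<r
      qt<rt : q ℚ.* t ℚ.< r ℚ.* t
      qt<rt = ℚ.*-monoˡ-<-pos t q<r
      qt<rs : q ℚ.* t ℚ.< r ℚ.* s
      qt<rs = ℚ.<-respˡ-≃
        (Ring.shift q s t)
        (ℚ.<-respʳ-≃
          (Ring.gapˢ q r s)
          (ℚ.+-monoʳ-< (q ℚ.* s) (small q q≤A)))
      qs<rt : q ℚ.* s ℚ.< r ℚ.* t
      qs<rt = ℚ.<-respˡ-≃
        (Ring.undo q r s t)
        (ℚ.<-respʳ-≃
          (Ring.gapᵗ q r s t)
          (ℚ.+-monoʳ-< (q ℚ.* s ℚ.+ r ℚ.* (t ℚ.- s)) (small (ℚ.- r) -r≤A)))

      below : q ℚ.* s <ʳ x → q ℚ.* t <ʳ x → Lower q ⊎ Upper r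
      below Lqs Lqt = inj₁ (s , t , 0<s , Ls , Ut , Lqs , Lqt)
      above : x ʳ< r ℚ.* s → x ʳ< r ℚ.* t → Lower q ⊎ Upper r
      above Urs Urt = inj₂ (s , t , 0<s , Ls , Ut , Urs , Urt)

      compare : q ℚ.* s ℚ.≤ q ℚ.* t ⊎ q ℚ.* t ℚ.≤ q ℚ.* s →
                r ℚ.* s ℚ.≤ r ℚ.* t ⊎ r ℚ.* t ℚ.≤ r ℚ.* s → Lower q ⊎ Upper r
      compare (inj₁ qs≤qt) (inj₁ rs≤rt) =
        [ (λ L → below (X.lower-≤ qs≤qt L) L) , (λ U → above U (X.upper-≤ rs≤rt U)) ]′ (X.located qt<rs)
      compare (inj₁ qs≤qt) (inj₂ rt≤rs) =
        [ (λ L → below (X.lower-≤ qs≤qt L) L) , (λ U → above (X.upper-≤ rt≤rs U) U) ]′ (X.located qt<rt)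
      compare (inj₂ qt≤qs) (inj₁ rs≤rt) =
        [ (λ L → below L (X.lower-≤ qt≤qs L)) , (λ U → above U (X.upper-≤ rs≤rt U)) ]′ (X.located qs<rs)
      compare (inj₂ qt≤qs) (inj₂ rt≤rs) =
        [ (λ L → below L (X.lower-≤ qt≤qs L)) , (λ U → above (X.upper-≤ rt≤rs U) U) ]′ (X.located qs<rt)

_/_[_] : (x y : ℝ) → 0ℚᵘ <ʳ y → ℝ
x / y [ y>0 ] = record { Quotient x y y>0 hiding (disjoint) ; disjoint = λ {q} → Quotient.disjoint x y y>0 {q} }

------------------------------------------------------------------------
-- Asymptotic equivalence

-- The quotients f n / g n need to be defined only for large n.
infix 4 _∼_
_∼_ : (f g : ℕ → ℝ) → Set
f ∼ g = ∀ ε → 0ℚᵘ ℚ.< ε → ∃ λ N → ∀ n → N ℕ.≤ n →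
        Σ (0ℚᵘ <ʳ g n) λ g>0 →
        1ℚᵘ ℚ.- ε <ʳ f n / g n [ g>0 ] × f n / g n [ g>0 ] ʳ< 1ℚᵘ ℚ.+ ε

{-# OPTIONS --safe #-}
-- A rank-two matroid is given by its loops and a partition of the other elements into
-- parallel classes.  Sending a non-loop to the least element of its class bounds m (n, 2)
-- by (n + 1)^n.  Sparse paving means that there are no loops and that all classes have at
-- most two elements, so for n ≥ 3 these matroids correspond to the matchings of Fin n, and
-- t (n + 2) = t (n + 1) + (n + 1) t n for the number t n of matchings yields
-- n! ≤ (t n)² ≤ (4 (n + 1))^n.  Retractions of Fin n onto its first k elements give
-- p (n, 2) ≥ k^(n - k), and also n! ≥ k^(n - k).  Hence s², p and m all lie between
-- k^(n - k) and (4 (n + 1))^n, and for a power of two k of order n / c with c large, the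
-- ratio of the logarithms of these bounds is close to 1.
module Submission where

open import Defs
open import Data.Bool.Base using (true; false)
open import Data.Fin.Base as Fin using (Fin; zero; suc)
import Data.Fin.Properties as Fin
open import Data.Fin.Subset using (Subset; inside; outside; _∈_; _∉_; _⊆_; _∪_; ⁅_⁆; ∁; ∣_∣)
  renaming (⊥ to ∅)
open import Data.Fin.Subset.Properties
open import Data.Integer.Base as ℤ using (+_; -[1+_])
import Data.Integer.Properties as ℤ
open import Data.List.Base using (List; []; _∷_; map; filter; length; lookup)
open import Data.List.Membership.Propositional using () renaming (_∈_ to _∈ᴸ_)
open import Data.List.Membership.Propositional.Properties
  using (∈-++⁺ˡ; ∈-++⁺ʳ; ∈-++⁻; ∈-map⁺; ∈-map⁻; ∈-lookup; ∈-filter⁺; ∈-filter⁻)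
import Data.List.Relation.Unary.All as All
open import Data.List.Relation.Unary.All using ([]; _∷_)
open import Data.List.Relation.Unary.AllPairs using ([]; _∷_)
open import Data.List.Relation.Unary.Any using (here; there; index)
open import Data.List.Relation.Unary.Any.Properties using (lookup-index)
open import Data.List.Relation.Unary.Unique.Propositional using (Unique)
import Data.List.Relation.Unary.Unique.Propositional.Properties as Unique
open import Data.Nat.Base as ℕ
  using (ℕ; zero; suc; s≤s; z≤n; nonZero; _!; _^_; _*_; _+_; _∸_; _≤_; _<_)
open import Data.Nat.Induction using (<-wellFounded)
import Data.Nat.Properties as ℕ
open import Data.Nat.Tactic.RingSolver using (solve-∀)
open import Data.Product using (_×_; _,_; proj₁; proj₂; ∃)
open import Data.Product.Function.NonDependent.Propositional using (_×-↔_)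
open import Data.Rational.Unnormalised.Base as ℚ using (ℚᵘ; mkℚᵘ; 0ℚᵘ; 1ℚᵘ; *<*; *≤*; *≡*)
import Data.Rational.Unnormalised.Properties as ℚ
open import Data.Rational.Unnormalised.Solver using (module +-*-Solver)
open import Data.Sum as Sum using (_⊎_; inj₁; inj₂; [_,_]′)
open import Data.Sum.Function.Propositional using (_⊎-↔_)
import Data.Sum.Properties as Sum
open import Data.Unit.Base using (⊤; tt)
open import Data.Vec.Base using ([]; _∷_; here; there)
import Data.Vec.Properties as Vec
open import Function using (_∘_; id; _↔_; Inverse; Injection)
open import Function.Properties.Inverse using (↔-refl; ↔-sym; ↔-trans; ↔⇒↣)
open import Induction.WellFounded using (Acc; acc)
open import Level using (0ℓ)
open import Relation.Binary.Definitions using (DecidableEquality)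
open import Relation.Binary.PropositionalEquality
open import Relation.Nullary using (¬_; ¬?; Dec; yes; no; does; contradiction)
open import Relation.Nullary.Decidable using (_×-dec_; _→-dec_; decidable-stable)
open import Relation.Unary using (Pred; Decidable)

-- Enumeration of sublists and of subsets.

lookup-injective : ∀ {A : Set} {xs : List A} → Unique xs →
                   ∀ i j → lookup xs i ≡ lookup xs j → i ≡ j
lookup-injective {xs = _ ∷ _}  _         zero    zero    _  = refl
lookup-injective {xs = _ ∷ xs} (x∉ ∷ _)  zero    (suc j) eq =
  contradiction eq (All.lookup x∉ (∈-lookup j))
lookup-injective {xs = _ ∷ xs} (x∉ ∷ _)  (suc i) zero    eq =
  contradiction (sym eq) (All.lookup x∉ (∈-lookup i))
lookup-injective {xs = _ ∷ _}  (_ ∷ xs!) (suc i) (suc j) eq =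
  cong suc (lookup-injective xs! i j eq)

module _ {A : Set} where

  ∈-sublists⇒⊆ : ∀ {xs ys : List A} → ys ∈ᴸ sublists xs → ∀ {y} → y ∈ᴸ ys → y ∈ᴸ xs
  ∈-sublists⇒⊆ {[]}     (here refl) y∈ = y∈
  ∈-sublists⇒⊆ {x ∷ xs} ys∈ y∈ with ∈-++⁻ (sublists xs) ys∈
  ... | inj₁ ys∈ˡ = there (∈-sublists⇒⊆ ys∈ˡ y∈)
  ... | inj₂ ys∈ʳ with ∈-map⁻ (x ∷_) ys∈ʳ | y∈
  ...   | _ , _   , refl | here refl = here refl
  ...   | _ , zs∈ , refl | there y∈′ = there (∈-sublists⇒⊆ zs∈ y∈′)

  sublists-unique : ∀ {xs : List A} → Unique xs → Unique (sublists xs)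
  sublists-unique []                     = [] ∷ []
  sublists-unique {x ∷ xs} (x∉ ∷ xs!) = Unique.++⁺ (sublists-unique xs!)
    (Unique.map⁺ (λ { refl → refl }) (sublists-unique xs!))
    (λ (ys∈ˡ , ys∈ʳ) → let zs , _ , eq = ∈-map⁻ (x ∷_) ys∈ʳ in
      All.lookup x∉ (∈-sublists⇒⊆ ys∈ˡ (subst (x ∈ᴸ_) (sym eq) (here refl))) refl)

  filter-∈-sublists : ∀ {P : Pred A 0ℓ} (P? : Decidable P) xs → filter P? xs ∈ᴸ sublists xs
  filter-∈-sublists P? []       = here refl
  filter-∈-sublists P? (x ∷ xs) with does (P? x)
  ... | true  = ∈-++⁺ʳ (sublists xs) (∈-map⁺ (x ∷_) (filter-∈-sublists P? xs))
  ... | false = ∈-++⁺ˡ (filter-∈-sublists P? xs)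

  -- A sublist keeps the order of `xs`, so its members determine it. Uniqueness of `xs` keeps the
  -- head `x` out of every sublist of the tail, which rules out the mixed cases and lets `x` be
  -- cancelled.
  sublists-extensional : ∀ {xs ys zs : List A} → Unique xs → ys ∈ᴸ sublists xs → zs ∈ᴸ sublists xs →
                         (∀ a → a ∈ᴸ ys → a ∈ᴸ zs) → (∀ a → a ∈ᴸ zs → a ∈ᴸ ys) → ys ≡ zs
  sublists-extensional {[]} _ (here refl) (here refl) _ _ = refl
  sublists-extensional {x ∷ xs} (x∉ ∷ xs!) ys∈ zs∈ ys⊆zs zs⊆ys
    with ∈-++⁻ (sublists xs) ys∈ | ∈-++⁻ (sublists xs) zs∈
  ... | inj₁ ys∈ˡ | inj₁ zs∈ˡ = sublists-extensional xs! ys∈ˡ zs∈ˡ ys⊆zs zs⊆ys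
  ... | inj₁ ys∈ˡ | inj₂ zs∈ʳ with _ , _ , refl ← ∈-map⁻ (x ∷_) zs∈ʳ =
    contradiction refl (All.lookup x∉ (∈-sublists⇒⊆ ys∈ˡ (zs⊆ys x (here refl))))
  ... | inj₂ ys∈ʳ | inj₁ zs∈ˡ with _ , _ , refl ← ∈-map⁻ (x ∷_) ys∈ʳ =
    contradiction refl (All.lookup x∉ (∈-sublists⇒⊆ zs∈ˡ (ys⊆zs x (here refl))))
  ... | inj₂ ys∈ʳ | inj₂ zs∈ʳ
    with _ , ys∈′ , refl ← ∈-map⁻ (x ∷_) ys∈ʳ | _ , zs∈′ , refl ← ∈-map⁻ (x ∷_) zs∈ʳ =
    cong (x ∷_) (sublists-extensional xs! ys∈′ zs∈′ (tail ys∈′ ys⊆zs) (tail zs∈′ zs⊆ys))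
    where
    tail : ∀ {us vs} → us ∈ᴸ sublists xs → (∀ a → a ∈ᴸ x ∷ us → a ∈ᴸ x ∷ vs) → ∀ a → a ∈ᴸ us → a ∈ᴸ vs
    tail us∈ sub a a∈ with sub a (there a∈)
    ... | there a∈vs = a∈vs
    ... | here refl  = contradiction refl (All.lookup x∉ (∈-sublists⇒⊆ us∈ a∈))

subsets-unique : ∀ n → Unique (subsets n)
subsets-unique zero    = [] ∷ []
subsets-unique (suc n) = Unique.++⁺
  (Unique.map⁺ Vec.∷-injectiveʳ (subsets-unique n))
  (Unique.map⁺ Vec.∷-injectiveʳ (subsets-unique n))
  (λ (A∈ˡ , A∈ʳ) → disjoint (∈-map⁻ _ A∈ˡ) (∈-map⁻ _ A∈ʳ))
  where
  disjoint : ∀ {A} → ∃ (λ B → B ∈ᴸ subsets n × A ≡ outside ∷ B) →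
             ∃ (λ B → B ∈ᴸ subsets n × A ≡ inside ∷ B) → _
  disjoint (_ , _ , refl) (_ , _ , ())

∈-subsets : ∀ {n} (A : Subset n) → A ∈ᴸ subsets n
∈-subsets []            = here refl
∈-subsets (outside ∷ A) = ∈-++⁺ˡ (∈-map⁺ (outside ∷_) (∈-subsets A))
∈-subsets (inside  ∷ A) = ∈-++⁺ʳ (map (outside ∷_) (subsets _)) (∈-map⁺ (inside ∷_) (∈-subsets A))

-- Counting set families by injections.

module Counting {n : ℕ} {Q : Pred (List (Subset n)) 0ℓ} (Q? : Decidable Q) where

  count : ℕ
  count = length (filter Q? (families n))

  -- The code may depend on the proof of `Q F`. One inclusion suffices as hypothesis: applying it to
  -- the equation and to its reverse gives equal members, hence equal lists.
  count-≤ : ∀ {N} (code : ∀ F → Q F → Fin N) →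
            (∀ {F G} (qF : Q F) (qG : Q G) → code F qF ≡ code G qG → ∀ A → Member F A → Member G A) →
            count ≤ N
  count-≤ code code-reflects = Fin.injective⇒≤ {f = λ i → code (at i) (at-Q i)} λ {i} {j} eq →
    lookup-injective (Unique.filter⁺ Q? (sublists-unique (subsets-unique n))) i j
      (sublists-extensional (subsets-unique n) (at-∈ i) (at-∈ j)
        (code-reflects _ _ eq) (code-reflects _ _ (sym eq)))
    where
    at : Fin count → List (Subset n)
    at = lookup (filter Q? (families n))
    at-∈ : ∀ i → at i ∈ᴸ families n
    at-∈ i = proj₁ (∈-filter⁻ Q? {xs = families n} (∈-lookup i))
    at-Q : ∀ i → Q (at i)
    at-Q i = proj₂ (∈-filter⁻ Q? {xs = families n} (∈-lookup i))

  -- Families are supplied as predicates and listed by filtering `subsets n`. Asking for `Q F` on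
  -- every list `F` with the members of `I i` spares the applications any reasoning about this
  -- filter.
  ≤-count : ∀ {N} {I : Fin N → Pred (Subset n) 0ℓ} (I? : ∀ i → Decidable (I i)) →
            (∀ i F → (∀ A → Member F A → I i A) → (∀ A → I i A → Member F A) → Q F) →
            (∀ i j → (∀ A → I i A → I j A) → (∀ A → I j A → I i A) → i ≡ j) →
            N ≤ count
  ≤-count {N} {I} I? I-Q I-injective = Fin.injective⇒≤ {f = λ i → index (family-∈ i)} λ {i} {j} eq →
    let F≡G = trans (lookup-index (family-∈ i))
                (trans (cong (lookup (filter Q? (families n))) eq) (sym (lookup-index (family-∈ j))))
    in I-injective i j (λ A → sound j A ∘ subst (A ∈ᴸ_) F≡G ∘ complete i A)
                       (λ A → sound i A ∘ subst (A ∈ᴸ_) (sym F≡G) ∘ complete j A)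
    where
    family : Fin N → List (Subset n)
    family i = filter (I? i) (subsets n)
    sound : ∀ i A → A ∈ᴸ family i → I i A
    sound i A A∈ = proj₂ (∈-filter⁻ (I? i) {xs = subsets n} A∈)
    complete : ∀ i A → I i A → A ∈ᴸ family i
    complete i A = ∈-filter⁺ (I? i) (∈-subsets A)
    family-∈ : ∀ i → family i ∈ᴸ filter Q? (families n)
    family-∈ i = ∈-filter⁺ Q? (filter-∈-sublists (I? i) (subsets n))
      (I-Q i (family i) (sound i) (complete i))

-- Subsets with few elements.

pair : ∀ {n} → Fin n → Fin n → Subset n
pair a b = ⁅ a ⁆ ∪ ⁅ b ⁆

∣⁅a⁆∪B∣ : ∀ {n} {a : Fin n} {B} → a ∉ B → ∣ ⁅ a ⁆ ∪ B ∣ ≡ suc ∣ B ∣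
∣⁅a⁆∪B∣ {a = zero}  {outside ∷ B} _   = cong (suc ∘ ∣_∣) (∪-identityˡ B)
∣⁅a⁆∪B∣ {a = zero}  {inside  ∷ B} a∉B = contradiction here a∉B
∣⁅a⁆∪B∣ {a = suc a} {outside ∷ B} a∉B = ∣⁅a⁆∪B∣ (a∉B ∘ there)
∣⁅a⁆∪B∣ {a = suc a} {inside  ∷ B} a∉B = cong suc (∣⁅a⁆∪B∣ (a∉B ∘ there))

∣A∣≡0⇒A≡∅ : ∀ {n} {A : Subset n} → ∣ A ∣ ≡ 0 → A ≡ ∅
∣A∣≡0⇒A≡∅ {A = []}          _  = refl
∣A∣≡0⇒A≡∅ {A = outside ∷ _} eq = cong (outside ∷_) (∣A∣≡0⇒A≡∅ eq)

uncons : ∀ {n k} {A : Subset n} → ∣ A ∣ ≡ suc k → ∃ λ a → ∃ λ B → a ∉ B × A ≡ ⁅ a ⁆ ∪ B × ∣ B ∣ ≡ k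
uncons {A = inside ∷ A} eq =
  zero , outside ∷ A , (λ ()) , cong (inside ∷_) (sym (∪-identityˡ A)) , ℕ.suc-injective eq
uncons {A = outside ∷ A} eq with uncons {A = A} eq
... | a , B , a∉B , A≡ , ∣B∣≡k =
  suc a , outside ∷ B , (λ { (there a∈B) → a∉B a∈B }) , cong (outside ∷_) A≡ , ∣B∣≡k

∣A∣≡1⇒singleton : ∀ {n} {A : Subset n} → ∣ A ∣ ≡ 1 → ∃ λ a → A ≡ ⁅ a ⁆
∣A∣≡1⇒singleton {A = A} eq with uncons {A = A} eq
... | a , B , _ , refl , ∣B∣≡0 = a , trans (cong (⁅ a ⁆ ∪_) (∣A∣≡0⇒A≡∅ ∣B∣≡0)) (∪-identityʳ ⁅ a ⁆)

∣A∣≡2⇒pair : ∀ {n} {A : Subset n} → ∣ A ∣ ≡ 2 → ∃ λ a → ∃ λ b → a ≢ b × A ≡ pair a b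
∣A∣≡2⇒pair {A = A} eq with uncons {A = A} eq
... | a , B , a∉B , refl , ∣B∣≡1 with ∣A∣≡1⇒singleton {A = B} ∣B∣≡1
... | b , refl = a , b , (λ { refl → a∉B (x∈⁅x⁆ a) }) , refl

∣A∣≥3⇒triple : ∀ {n k} {A : Subset n} → ∣ A ∣ ≡ 3 + k →
               ∃ λ a → ∃ λ b → ∃ λ c → (a ∈ A × b ∈ A × c ∈ A) × (a ≢ b × a ≢ c × b ≢ c)
∣A∣≥3⇒triple {A = A} eq with uncons {A = A} eq
... | a , A′ , a∉ , refl , eq₁ with uncons {A = A′} eq₁
... | b , A″ , b∉ , refl , eq₂ with uncons {A = A″} eq₂
... | c , C , _ , refl , _ = a , b , c ,
  (p⊆p∪q _ (x∈⁅x⁆ a) , q⊆p∪q ⁅ a ⁆ _ b∈ , q⊆p∪q ⁅ a ⁆ _ c∈) ,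
  (λ { refl → a∉ b∈ }) , (λ { refl → a∉ c∈ }) , (λ { refl → b∉ c∈′ })
  where
  c∈′ : c ∈ ⁅ c ⁆ ∪ C
  c∈′ = p⊆p∪q C (x∈⁅x⁆ c)
  b∈ : b ∈ ⁅ b ⁆ ∪ (⁅ c ⁆ ∪ C)
  b∈ = p⊆p∪q _ (x∈⁅x⁆ b)
  c∈ : c ∈ ⁅ b ⁆ ∪ (⁅ c ⁆ ∪ C)
  c∈ = q⊆p∪q ⁅ b ⁆ _ c∈′

∣pair∣ : ∀ {n} {a b : Fin n} → a ≢ b → ∣ pair a b ∣ ≡ 2
∣pair∣ {b = b} a≢b = trans (∣⁅a⁆∪B∣ (x≢y⇒x∉⁅y⁆ a≢b)) (cong suc (∣⁅x⁆∣≡1 b))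

∈-pair⁻ : ∀ {n} {x : Fin n} a b → x ∈ pair a b → x ≡ a ⊎ x ≡ b
∈-pair⁻ a b x∈ = [ inj₁ ∘ x∈⁅y⁆⇒x≡y a , inj₂ ∘ x∈⁅y⁆⇒x≡y b ]′ (x∈p∪q⁻ ⁅ a ⁆ ⁅ b ⁆ x∈)

a∈pair : ∀ {n} (a b : Fin n) → a ∈ pair a b
a∈pair a b = p⊆p∪q ⁅ b ⁆ (x∈⁅x⁆ a)

b∈pair : ∀ {n} (a b : Fin n) → b ∈ pair a b
b∈pair a b = q⊆p∪q ⁅ a ⁆ ⁅ b ⁆ (x∈⁅x⁆ b)

⁅a⁆⊆ : ∀ {n} {a : Fin n} {A} → a ∈ A → ⁅ a ⁆ ⊆ A
⁅a⁆⊆ {a = a} {A} a∈A x∈ = subst (_∈ A) (sym (x∈⁅y⁆⇒x≡y a x∈)) a∈A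

pair⊆ : ∀ {n} {a b : Fin n} {A} → a ∈ A → b ∈ A → pair a b ⊆ A
pair⊆ {a = a} {b} {A} a∈A b∈A x∈ with ∈-pair⁻ a b x∈
... | inj₁ refl = a∈A
... | inj₂ refl = b∈A

⊆∧≥⇒≡ : ∀ {n} {A B : Subset n} → A ⊆ B → ∣ B ∣ ≤ ∣ A ∣ → B ≡ A
⊆∧≥⇒≡ {A = A} {B} A⊆B ∣B∣≤∣A∣ = ⊆-antisym B⊆A A⊆B
  where
  B⊆A : B ⊆ A
  B⊆A {x} x∈B with x ∈? A
  ... | yes x∈A = x∈A
  ... | no  x∉A = contradiction (p⊂q⇒∣p∣<∣q∣ (A⊆B , x , x∈B , x∉A)) (ℕ.≤⇒≯ ∣B∣≤∣A∣)

⊆∁-sym : ∀ {n} {A B : Subset n} → A ⊆ ∁ B → B ⊆ ∁ A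
⊆∁-sym A⊆∁B x∈B = x∉p⇒x∈∁p λ x∈A → x∈p⇒x∉∁p x∈B (A⊆∁B x∈A)

-- Circuits, bases and duals.

dependent⇒circuit : ∀ {n} {I : Pred (Subset n) 0ℓ} → Decidable I → ∀ A → ¬ I A →
                    ∃ λ C → C ⊆ A × Circuit I C
dependent⇒circuit {n} {I} I? A = go A (<-wellFounded ∣ A ∣)
  where
  go : ∀ A → Acc _<_ ∣ A ∣ → ¬ I A → ∃ λ C → C ⊆ A × Circuit I C
  go A (acc rec) ¬IA with anySubset? (λ B → (B ⊂? A) ×-dec ¬? (I? B))
  ... | yes (B , B⊂A , ¬IB) = let C , C⊆B , circuit = go B (rec (p⊂q⇒∣p∣<∣q∣ B⊂A)) ¬IB
                              in C , (proj₁ B⊂A ∘ C⊆B) , circuit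
  ... | no  none = A , id , ¬IA , λ B B⊂A → decidable-stable (I? B) λ ¬IB → none (B , B⊂A , ¬IB)

module MatroidProperties {n : ℕ} {I : Pred (Subset n) 0ℓ} (M : IsMatroid I) where
  open IsMatroid M

  independent-≤-basis : ∀ {A B} → I A → Basis I B → ∣ A ∣ ≤ ∣ B ∣
  independent-≤-basis {A} {B} IA (IB , maximal) = ℕ.≮⇒≥ λ ∣B∣<∣A∣ →
    let e , _ , e∉B , I[B∪e] = augmentation B A IB IA ∣B∣<∣A∣
        B∪e≡B = maximal (B ∪ ⁅ e ⁆) I[B∪e] (p⊆p∪q ⁅ e ⁆)
    in e∉B (subst (e ∈_) B∪e≡B (q⊆p∪q B ⁅ e ⁆ (x∈⁅x⁆ e)))

  independent-≤-rank : ∀ {r A} → HasRank I r → I A → ∣ A ∣ ≤ r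
  independent-≤-rank (B , basis , refl) IA = independent-≤-basis IA basis

  basis-size : ∀ {r B} → HasRank I r → Basis I B → ∣ B ∣ ≡ r
  basis-size rank@(_ , basis′ , refl) basis@(IB , _) = ℕ.≤-antisym
    (independent-≤-rank rank IB) (independent-≤-basis (proj₁ basis′) basis)

  -- Maximality holds because all bases have the same size: a dually independent set lies in the
  -- complement of some basis, which is no larger than `∁ B`.
  dual-basis : ∀ {B} → Basis I B → Basis (Dual I) (∁ B)
  dual-basis {B} basis = (B , basis , id) , λ where
    A (B′ , basis′ , A⊆∁B′) ∁B⊆A →
      let ∣∁B′∣≤∣∁B∣ = ℕ.≤-reflexive (trans (∣∁p∣≡n∸∣p∣ B′) (trans
            (cong (n ∸_) (sym (basis-size (B′ , basis′ , refl) basis))) (sym (∣∁p∣≡n∸∣p∣ B))))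
      in ⊆∧≥⇒≡ ∁B⊆A (ℕ.≤-trans (p⊆q⇒∣p∣≤∣q∣ A⊆∁B′) ∣∁B′∣≤∣∁B∣)

  dual-hasRank : ∀ {r} → HasRank I r → HasRank (Dual I) (n ∸ r)
  dual-hasRank (B , basis , refl) = ∁ B , dual-basis basis , ∣∁p∣≡n∸∣p∣ B

-- Rank-two matroids from colourings

module Rainbow {n : ℕ} {C : Set} (_≟_ : DecidableEquality C) (c : Fin n → C) where

  -- If at least two colours occur, these are the independent sets of the loopless rank-two matroid
  -- whose parallel classes are the colour classes.
  RainbowSet : Pred (Subset n) 0ℓ
  RainbowSet A = ∣ A ∣ ≤ 2 × (∀ a b → a ∈ A → b ∈ A → c a ≡ c b → a ≡ b)

  rainbow? : Decidable RainbowSet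
  rainbow? A = (∣ A ∣ ℕ.≤? 2) ×-dec
    Fin.all? λ a → Fin.all? λ b → (a ∈? A) →-dec ((b ∈? A) →-dec ((c a ≟ c b) →-dec (a Fin.≟ b)))

  ∣A∣≤1⇒rainbow : ∀ {A} → ∣ A ∣ ≤ 1 → RainbowSet A
  ∣A∣≤1⇒rainbow {A} ∣A∣≤1 = ℕ.m≤n⇒m≤1+n ∣A∣≤1 , λ a b a∈A b∈A _ → injective a b a∈A b∈A
    where
    injective : ∀ a b → a ∈ A → b ∈ A → a ≡ b
    injective a b a∈A b∈A with a Fin.≟ b
    ... | yes a≡b = a≡b
    ... | no  a≢b = contradiction (ℕ.≤-trans (p⊆q⇒∣p∣≤∣q∣ (pair⊆ a∈A b∈A)) ∣A∣≤1)
                      (subst (λ k → ¬ k ≤ 1) (sym (∣pair∣ a≢b)) λ { (s≤s ()) })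

  pair-rainbow : ∀ {a b} → c a ≢ c b → RainbowSet (pair a b)
  pair-rainbow {a} {b} ca≢cb = ℕ.≤-reflexive (∣pair∣ (ca≢cb ∘ cong c)) , injective
    where
    injective : ∀ x y → x ∈ pair a b → y ∈ pair a b → c x ≡ c y → x ≡ y
    injective x y x∈ y∈ eq with ∈-pair⁻ a b x∈ | ∈-pair⁻ a b y∈
    ... | inj₁ refl | inj₁ refl = refl
    ... | inj₁ refl | inj₂ refl = contradiction eq ca≢cb
    ... | inj₂ refl | inj₁ refl = contradiction (sym eq) ca≢cb
    ... | inj₂ refl | inj₂ refl = refl

  -- The essential case has one element in `A` and two in `B`: the elements of `B` differ in colour,
  -- so at least one of them differs in colour from the element of `A`.
  rainbow-augment : ∀ A B → RainbowSet A → RainbowSet B → ∣ A ∣ < ∣ B ∣ →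
                    ∃ λ e → e ∈ B × e ∉ A × RainbowSet (A ∪ ⁅ e ⁆)
  rainbow-augment A B (_ , _) (∣B∣≤2 , B-injective) ∣A∣<∣B∣ with ∣ A ∣ in ∣A∣≡
  ... | zero with refl ← ∣A∣≡0⇒A≡∅ {A = A} ∣A∣≡
             with b , B′ , _ , refl , _ ← uncons {A = B} (sym (ℕ.suc-pred ∣ B ∣ {{ℕ.>-nonZero ∣A∣<∣B∣}})) =
    b , p⊆p∪q B′ (x∈⁅x⁆ b) , ∉⊥ ,
    subst RainbowSet (sym (∪-identityˡ ⁅ b ⁆)) (∣A∣≤1⇒rainbow (ℕ.≤-reflexive (∣⁅x⁆∣≡1 b)))
  ... | suc (suc _) = contradiction (ℕ.≤-trans ∣A∣<∣B∣ ∣B∣≤2) λ { (s≤s (s≤s ())) }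
  ... | suc zero with ∣A∣≡1⇒singleton {A = A} ∣A∣≡ | ∣A∣≡2⇒pair {A = B} (ℕ.≤-antisym ∣B∣≤2 ∣A∣<∣B∣)
  ... | a , refl | b , b′ , b≢b′ , refl with c a ≟ c b
  ...   | no  ca≢cb = b , a∈pair b b′ , x≢y⇒x∉⁅y⁆ (ca≢cb ∘ sym ∘ cong c) , pair-rainbow ca≢cb
  ...   | yes ca≡cb = b′ , b∈pair b b′ , x≢y⇒x∉⁅y⁆ (ca≢cb′ ∘ sym ∘ cong c) , pair-rainbow ca≢cb′
    where
    ca≢cb′ : c a ≢ c b′
    ca≢cb′ eq = b≢b′ (B-injective b b′ (a∈pair b b′) (b∈pair b b′) (trans (sym ca≡cb) eq))

  -- `I` agrees with `RainbowSet` only extensionally, so that it may be the membership predicate of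
  -- a list.
  module _ {I : Pred (Subset n) 0ℓ}
           (sound : ∀ A → I A → RainbowSet A) (complete : ∀ A → RainbowSet A → I A) where

    isMatroid : IsMatroid I
    isMatroid = record
      { empty        = complete ∅ (∣A∣≤1⇒rainbow (subst (_≤ 1) (sym (∣⊥∣≡0 n)) z≤n))
      ; hereditary   = λ A B A⊆B IB → let ∣B∣≤2 , injective = sound B IB in
          complete A (ℕ.≤-trans (p⊆q⇒∣p∣≤∣q∣ A⊆B) ∣B∣≤2 , λ a b a∈ b∈ → injective a b (A⊆B a∈) (A⊆B b∈))
      ; augmentation = λ A B IA IB ∣A∣<∣B∣ →
          let e , e∈B , e∉A , rainbow = rainbow-augment A B (sound A IA) (sound B IB) ∣A∣<∣B∣
          in e , e∈B , e∉A , complete _ rainbow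
      }

    pair-basis : ∀ {a b} → c a ≢ c b → Basis I (pair a b)
    pair-basis ca≢cb = complete _ (pair-rainbow ca≢cb) , λ A IA pair⊆A →
      ⊆∧≥⇒≡ pair⊆A (ℕ.≤-trans (proj₁ (sound A IA)) (ℕ.≤-reflexive (sym (∣pair∣ (ca≢cb ∘ cong c)))))

    module _ {a b : Fin n} (ca≢cb : c a ≢ c b) where

      matroidOfRank2 : MatroidOfRank 2 I
      matroidOfRank2 = isMatroid , pair _ _ , pair-basis ca≢cb , ∣pair∣ (ca≢cb ∘ cong c)

      paving : Paving I
      paving r (B , (IB , _) , refl) C (¬IC , _) = ℕ.≤-trans (proj₁ (sound B IB))
        (ℕ.≮⇒≥ λ { (s≤s ∣C∣≤1) → ¬IC (complete C (∣A∣≤1⇒rainbow ∣C∣≤1)) })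

      -- A set dependent in the dual has a complement containing no basis, hence a monochromatic
      -- one. If the set has fewer than `n ∸ 2` elements, this complement holds three elements of
      -- one colour.
      dual-paving : (∀ x y z → c x ≡ c y → c x ≡ c z → x ≡ y ⊎ x ≡ z ⊎ y ≡ z) → Paving (Dual I)
      dual-paving classes≤2 r (D , ((B , basis , D⊆∁B) , _) , refl) X (¬dual , _) =
        ℕ.≤-trans ∣D∣≤n-2 (ℕ.≮⇒≥ λ ∣X∣<n-2 → small ∣X∣<n-2)
        where
        ∣D∣≤n-2 : ∣ D ∣ ≤ n ∸ 2
        ∣D∣≤n-2 = ℕ.≤-trans (p⊆q⇒∣p∣≤∣q∣ D⊆∁B) (ℕ.≤-reflexive (trans (∣∁p∣≡n∸∣p∣ B)
          (cong (n ∸_) (MatroidProperties.basis-size isMatroid (proj₂ matroidOfRank2) basis))))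

        monochromatic : ∀ {x y} → x ∈ ∁ X → y ∈ ∁ X → c x ≡ c y
        monochromatic {x} {y} x∈ y∈ = decidable-stable (c x ≟ c y) λ cx≢cy →
          ¬dual (_ , pair-basis cx≢cy , ⊆∁-sym (pair⊆ x∈ y∈))

        small : ¬ ∣ X ∣ < n ∸ 2
        small ∣X∣<n-2 with ∣A∣≥3⇒triple {A = ∁ X} (sym (ℕ.m+[n∸m]≡n 3≤∣∁X∣))
          where
          3≤∣∁X∣ : 3 ≤ ∣ ∁ X ∣
          3≤∣∁X∣ = subst (3 ≤_) (sym (∣∁p∣≡n∸∣p∣ X)) (ℕ.m+n≤o⇒m≤o∸n 3
            (subst (_≤ n) (cong suc (ℕ.+-comm ∣ X ∣ 2)) (ℕ.m≤o∸n⇒m+n≤o (suc ∣ X ∣) 2≤n ∣X∣<n-2)))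
            where
            -- Subtraction is truncated, but `n ∸ 2` exceeds `∣ X ∣` and so is nonzero.
            2≤n : 2 ≤ n
            2≤n = ℕ.<⇒≤ (ℕ.m∸n≢0⇒n<m (ℕ.m<n⇒n≢0 ∣X∣<n-2))
        ... | x , y , z , (x∈ , y∈ , z∈) , x≢y , x≢z , y≢z
          with classes≤2 x y z (monochromatic x∈ y∈) (monochromatic x∈ z∈)
        ...   | inj₁ x≡y        = x≢y x≡y
        ...   | inj₂ (inj₁ x≡z) = x≢z x≡z
        ...   | inj₂ (inj₂ y≡z) = y≢z y≡z

-- Independence of small sets, and least witnesses.

small⇒independent : ∀ {n r} {I : Pred (Subset n) 0ℓ} → Decidable I → Paving I → HasRank I r →
                    ∀ {A} → ∣ A ∣ < r → I A
small⇒independent I? paving rank {A} ∣A∣<r = decidable-stable (I? A) λ ¬IA →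
  let C , C⊆A , circuit = dependent⇒circuit I? A ¬IA
  in ℕ.<⇒≱ ∣A∣<r (ℕ.≤-trans (paving _ rank C circuit) (p⊆q⇒∣p∣≤∣q∣ C⊆A))

-- Shifted by one: suc i for the first i satisfying the predicate, zero if there is none.
first : ∀ {n} {P : Pred (Fin n) 0ℓ} → Decidable P → Fin (suc n)
first {zero}  P? = zero
first {suc n} P? with P? zero | first (P? ∘ suc)
... | yes _ | _     = suc zero
... | no  _ | zero  = zero
... | no  _ | suc i = suc (suc i)

first-sound : ∀ {n} {P : Pred (Fin n) 0ℓ} (P? : Decidable P) {i} → first P? ≡ suc i → P i
first-sound {suc n} P? eq with P? zero | first (P? ∘ suc) in eq′
first-sound {suc n} P? refl | yes Pzero | _     = Pzero
first-sound {suc n} P? refl | no  _     | suc i = first-sound (P? ∘ suc) eq′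

first-complete : ∀ {n} {P : Pred (Fin n) 0ℓ} (P? : Decidable P) {i} → P i → ∃ λ j → first P? ≡ suc j
first-complete {suc n} P? {i} Pi with P? zero | first (P? ∘ suc) in eq
first-complete {suc n} P? {i}     Pi | yes _   | _     = zero , refl
first-complete {suc n} P? {zero}  Pi | no ¬P   | _     = contradiction Pi ¬P
first-complete {suc n} P? {suc i} Pi | no _    | suc j = suc j , refl
first-complete {suc n} P? {suc i} Pi | no _    | zero
  with () ← trans (sym eq) (proj₂ (first-complete (P? ∘ suc) Pi))

-- Makes the least element of a parallel class the same whichever member of the class the search
-- starts from.
first-cong : ∀ {n} {P Q : Pred (Fin n) 0ℓ} (P? : Decidable P) (Q? : Decidable Q) →
             (∀ i → P i → Q i) → (∀ i → Q i → P i) → first P? ≡ first Q?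
first-cong {zero}  _  _  _ _ = refl
first-cong {suc n} P? Q? P⇒Q Q⇒P
  with P? zero | Q? zero | first (P? ∘ suc) | first (Q? ∘ suc)
     | first-cong (P? ∘ suc) (Q? ∘ suc) (P⇒Q ∘ suc) (Q⇒P ∘ suc)
... | yes _  | yes _  | _     | _ | _    = refl
... | yes p  | no ¬q  | _     | _ | _    = contradiction (P⇒Q zero p) ¬q
... | no ¬p  | yes q  | _     | _ | _    = contradiction (Q⇒P zero q) ¬p
... | no _   | no _   | zero  | _ | refl = refl
... | no _   | no _   | suc _ | _ | refl = refl

-- Rank-two matroids from their parallel classes

-- Since `pair a a` is a singleton, dependence is asked only for `a ≢ b`. Thus `a` is parallel to
-- itself exactly when it is not a loop, and the relation records the loops as well as the classes.
Parallel : ∀ {n} → Pred (Subset n) 0ℓ → Fin n → Fin n → Set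
Parallel I a b = I ⁅ a ⁆ × I ⁅ b ⁆ × (a ≢ b → ¬ I (pair a b))

module RankTwo {n : ℕ} {I : Pred (Subset n) 0ℓ} (I? : Decidable I) (M : MatroidOfRank 2 I) where
  open IsMatroid (proj₁ M)
  open MatroidProperties (proj₁ M)

  parallel? : ∀ a b → Dec (Parallel I a b)
  parallel? a b = I? ⁅ a ⁆ ×-dec (I? ⁅ b ⁆ ×-dec (¬? (a Fin.≟ b) →-dec ¬? (I? (pair a b))))

  parallel-refl : ∀ {a} → I ⁅ a ⁆ → Parallel I a a
  parallel-refl Ia = Ia , Ia , λ a≢a _ → a≢a refl

  parallel-sym : ∀ {a b} → Parallel I a b → Parallel I b a
  parallel-sym {a} {b} (Ia , Ib , dep) =
    Ib , Ia , λ b≢a Iba → dep (b≢a ∘ sym) (subst I (∪-comm ⁅ b ⁆ ⁅ a ⁆) Iba)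

  -- If `pair a d` were independent, augmenting `⁅ b ⁆` from it would make `b` independent together
  -- with `a` or `d`, although it is parallel to both.
  parallel-trans : ∀ {a b d} → Parallel I a b → Parallel I b d → Parallel I a d
  parallel-trans {a} {b} {d} ab@(Ia , Ib , _) bd@(_ , Id , _) = Ia , Id , λ a≢d Iad →
    let e , e∈ , e∉ , I[b∪e] = augmentation ⁅ b ⁆ (pair a d) Ib Iad
          (subst₂ _<_ (sym (∣⁅x⁆∣≡1 b)) (sym (∣pair∣ a≢d)) ℕ.≤-refl)
        b≢e = x∉⁅y⁆⇒x≢y e∉ ∘ sym
    in proj₂ (proj₂ (parallel-b ab bd (∈-pair⁻ a d e∈))) b≢e I[b∪e]
    where
    parallel-b : ∀ {e} → Parallel I a b → Parallel I b d → e ≡ a ⊎ e ≡ d → Parallel I b e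
    parallel-b ab bd (inj₁ refl) = parallel-sym ab
    parallel-b ab bd (inj₂ refl) = bd

  -- Loops receive zero, since they are parallel to nothing; this extra value accounts for the base
  -- `n + 1` in the bound on `m n 2`.
  classOf : Fin n → Fin (suc n)
  classOf a = first (parallel? a)

  classOf-complete : ∀ {a b} → Parallel I a b → classOf a ≡ classOf b
  classOf-complete ab = first-cong (parallel? _) (parallel? _)
    (λ _ → parallel-trans (parallel-sym ab)) (λ _ → parallel-trans ab)

  classOf-nonzero : ∀ {a b} → Parallel I a b → ∃ λ r → classOf a ≡ suc r
  classOf-nonzero = first-complete (parallel? _)

  classOf-sound : ∀ {a b r} → classOf a ≡ suc r → classOf b ≡ suc r → Parallel I a b
  classOf-sound ca cb =
    parallel-trans (first-sound (parallel? _) ca) (parallel-sym (first-sound (parallel? _) cb))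

  ∣A∣≤2 : ∀ {A} → I A → ∣ A ∣ ≤ 2
  ∣A∣≤2 = independent-≤-rank (proj₂ M)

  module _ {J : Pred (Subset n) 0ℓ} (J? : Decidable J) (N : MatroidOfRank 2 J)
           (I⇒J : ∀ a b → Parallel I a b → Parallel J a b)
           (J⇒I : ∀ a b → Parallel J a b → Parallel I a b) where

    -- Independent sets have at most two elements. For a pair, both singletons are independent in
    -- `J`; were the pair dependent there, its elements would be parallel in `J`, hence in `I`,
    -- against its independence in `I`.
    parallel-determines : ∀ A → I A → J A
    parallel-determines A IA with ∣ A ∣ in eq | ∣A∣≤2 IA
    ... | 0 | _ = subst J (sym (∣A∣≡0⇒A≡∅ eq)) (IsMatroid.empty (proj₁ N))
    ... | 1 | _ with a , refl ← ∣A∣≡1⇒singleton {A = A} eq = proj₁ (I⇒J a a (parallel-refl IA))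
    ... | 2 | _ with a , b , a≢b , refl ← ∣A∣≡2⇒pair {A = A} eq =
      decidable-stable (J? A) λ ¬J →
        let a∥b = J-singleton a (a∈pair a b) , J-singleton b (b∈pair a b) , λ _ → ¬J
        in proj₂ (proj₂ (J⇒I a b a∥b)) a≢b IA
      where
      J-singleton : ∀ x → x ∈ A → J ⁅ x ⁆
      J-singleton x x∈A = proj₁ (I⇒J x x (parallel-refl (hereditary ⁅ x ⁆ A (⁅a⁆⊆ x∈A) IA)))
    ... | suc (suc (suc _)) | s≤s (s≤s ())

  module _ (sparse : SparsePaving I) where

    loopless : ∀ a → I ⁅ a ⁆
    loopless a = small⇒independent I? (proj₁ sparse) (proj₂ M) (ℕ.≤-reflexive (cong suc (∣⁅x⁆∣≡1 a)))

    -- For a class containing a triple T, ∁ T is smaller than the rank n - 2 of the dual,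
    -- hence independent there, so T contains a basis, which is impossible.
    parallel-classes≤2 : ∀ a b d → Parallel I a b → Parallel I a d → a ≡ b ⊎ a ≡ d ⊎ b ≡ d
    parallel-classes≤2 a b d ab ad with a Fin.≟ b | a Fin.≟ d | b Fin.≟ d
    ... | yes a≡b | _       | _       = inj₁ a≡b
    ... | no _    | yes a≡d | _       = inj₂ (inj₁ a≡d)
    ... | no _    | no _    | yes b≡d = inj₂ (inj₂ b≡d)
    ... | no a≢b  | no a≢d  | no b≢d  =
      let B , basis@(IB , _) , ∁T⊆∁B = dual-∁T
          x , y , x≢y , B≡ = ∣A∣≡2⇒pair {A = B} (basis-size (proj₂ M) basis)
          B⊆T = ∁p⊆∁q⇒p⊇q ∁T⊆∁B
          x∈T = B⊆T (subst (x ∈_) (sym B≡) (a∈pair x y))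
          y∈T = B⊆T (subst (y ∈_) (sym B≡) (b∈pair x y))
          xy = parallel-trans (parallel-sym (a∥T x∈T)) (a∥T y∈T)
      in contradiction (subst I B≡ IB) (proj₂ (proj₂ xy) x≢y)
      where
      T : Subset n
      T = ⁅ a ⁆ ∪ pair b d

      a∥T : ∀ {x} → x ∈ T → Parallel I a x
      a∥T x∈T with x∈p∪q⁻ ⁅ a ⁆ (pair b d) x∈T
      ... | inj₁ x∈a with refl ← x∈⁅y⁆⇒x≡y a x∈a = parallel-refl (loopless a)
      ... | inj₂ x∈bd with ∈-pair⁻ b d x∈bd
      ...   | inj₁ refl = ab
      ...   | inj₂ refl = ad

      ∣T∣≡3 : ∣ T ∣ ≡ 3
      ∣T∣≡3 = trans (∣⁅a⁆∪B∣ ([ a≢b , a≢d ]′ ∘ ∈-pair⁻ b d)) (cong suc (∣pair∣ b≢d))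

      ∣∁T∣<n-2 : ∣ ∁ T ∣ < n ∸ 2
      ∣∁T∣<n-2 = ℕ.≤-trans
        (s≤s (ℕ.≤-reflexive (trans (∣∁p∣≡n∸∣p∣ T) (cong (n ∸_) ∣T∣≡3))))
        (ℕ.≤-reflexive (sym (ℕ.+-∸-assoc 1 (subst (_≤ n) ∣T∣≡3 (∣p∣≤n T)))))

      dual-∁T : Dual I (∁ T)
      dual-∁T = small⇒independent (dual? I?) (proj₂ sparse) (dual-hasRank (proj₂ M)) ∣∁T∣<n-2

-- Matchings

-- In inj₁ μ the vertex 0 is unmatched; in inj₂ (j , μ) it is matched with suc j,
-- and μ matches the remaining vertices, relabelled along suc ∘ punchIn j.
Matching : ℕ → Set
Matching 0             = ⊤
Matching 1             = ⊤
Matching (suc (suc n)) = Matching (suc n) ⊎ (Fin (suc n) × Matching n)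

-- The telephone numbers 1, 1, 2, 4, 10, 26, which also count involutions.
#matchings : ℕ → ℕ
#matchings 0             = 1
#matchings 1             = 1
#matchings (suc (suc n)) = #matchings (suc n) + suc n * #matchings n

Fin↔Matching : ∀ n → Fin (#matchings n) ↔ Matching n
Fin↔Matching 0             = Fin.1↔⊤
Fin↔Matching 1             = Fin.1↔⊤
Fin↔Matching (suc (suc n)) =
  ↔-trans Fin.+↔⊎ (Fin↔Matching (suc n) ⊎-↔ ↔-trans Fin.*↔× (↔-refl ×-↔ Fin↔Matching n))

-- The colour of a vertex is the least vertex of its block, a block being a matched pair or an
-- unmatched vertex.
colour : ∀ n → Matching n → Fin n → Fin n
colour 1             _              a       = a
colour (suc (suc n)) (inj₁ μ)       zero    = zero
colour (suc (suc n)) (inj₁ μ)       (suc a) = suc (colour (suc n) μ a)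
colour (suc (suc n)) (inj₂ (j , μ)) zero    = zero
colour (suc (suc n)) (inj₂ (j , μ)) (suc a) with j Fin.≟ a
... | yes _  = zero
... | no j≢a = suc (Fin.punchIn j (colour n μ (Fin.punchOut j≢a)))

-- A view of the vertices relative to the edge from 0 to `suc j`; case analysis on it keeps
-- `punchOut` out of the later proofs.
data Position {n : ℕ} (j : Fin (suc n)) : Fin (suc (suc n)) → Set where
  start : Position j zero
  end   : Position j (suc j)
  other : ∀ i → Position j (suc (Fin.punchIn j i))

position : ∀ {n} (j : Fin (suc n)) a → Position j a
position j zero = start
position j (suc a) with j Fin.≟ a
... | yes refl = end
... | no  j≢a  = subst (Position j ∘ suc) (Fin.punchIn-punchOut j≢a) (other (Fin.punchOut j≢a))

module _ {n : ℕ} (j : Fin (suc n)) (μ : Matching n) where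
  private
    c : Fin (suc (suc n)) → Fin (suc (suc n))
    c = colour (suc (suc n)) (inj₂ (j , μ))

  colour-end : c (suc j) ≡ zero
  colour-end with j Fin.≟ j
  ... | yes _   = refl
  ... | no  j≢j = contradiction refl j≢j

  colour-other : ∀ i → c (suc (Fin.punchIn j i)) ≡ suc (Fin.punchIn j (colour n μ i))
  colour-other i with j Fin.≟ Fin.punchIn j i
  ... | yes j≡ = contradiction (sym j≡) (Fin.punchInᵢ≢i j i)
  ... | no  j≢ = cong (suc ∘ Fin.punchIn j ∘ colour n μ)
    (trans (Fin.punchOut-cong j {i≢j = j≢} refl) (Fin.punchOut-punchIn j))

  start≢other : ∀ {i} → zero ≢ c (suc (Fin.punchIn j i))
  start≢other {i} eq with () ← trans eq (colour-other i)

  end≢other : ∀ {i} → c (suc j) ≢ c (suc (Fin.punchIn j i))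
  end≢other eq = start≢other (trans (sym colour-end) eq)

  other-cong : ∀ {i k} → colour n μ i ≡ colour n μ k → c (suc (Fin.punchIn j i)) ≡ c (suc (Fin.punchIn j k))
  other-cong {i} {k} eq =
    trans (colour-other i) (trans (cong (suc ∘ Fin.punchIn j) eq) (sym (colour-other k)))

  other-injective : ∀ {i k} → c (suc (Fin.punchIn j i)) ≡ c (suc (Fin.punchIn j k)) → colour n μ i ≡ colour n μ k
  other-injective {i} {k} eq = Fin.punchIn-injective j _ _
    (Fin.suc-injective (trans (sym (colour-other i)) (trans eq (colour-other k))))

  start-partner : ∀ k → zero ≡ c (suc k) → j ≡ k
  start-partner k eq with position j (suc k)
  ... | end     = refl
  ... | other _ = contradiction eq start≢other

AtMostPairs : {A : Set} → (A → A → Set) → Set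
AtMostPairs R = ∀ a b d → R a b → R a d → a ≡ b ⊎ a ≡ d ⊎ b ≡ d

SameColour : ∀ n → Matching n → Fin n → Fin n → Set
SameColour n μ a b = colour n μ a ≡ colour n μ b

sameColour-atMostPairs : ∀ n μ → AtMostPairs (SameColour n μ)
sameColour-atMostPairs 1 _ zero zero _ _ _ = inj₁ refl
sameColour-atMostPairs (suc (suc n)) (inj₁ μ) zero    zero    _       _ _ = inj₁ refl
sameColour-atMostPairs (suc (suc n)) (inj₁ μ) zero    (suc _) zero    _ _ = inj₂ (inj₁ refl)
sameColour-atMostPairs (suc (suc n)) (inj₁ μ) (suc a) (suc b) (suc d) ab ad =
  Sum.map (cong suc) (Sum.map (cong suc) (cong suc))
    (sameColour-atMostPairs (suc n) μ a b d (Fin.suc-injective ab) (Fin.suc-injective ad))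
sameColour-atMostPairs (suc (suc n)) (inj₂ (j , μ)) a b d ab ad
  with position j a | position j b | position j d
... | start   | start   | _       = inj₁ refl
... | start   | end     | start   = inj₂ (inj₁ refl)
... | start   | end     | end     = inj₂ (inj₂ refl)
... | start   | end     | other _ = contradiction ad (start≢other j μ)
... | start   | other _ | _       = contradiction ab (start≢other j μ)
... | end     | end     | _       = inj₁ refl
... | end     | start   | start   = inj₂ (inj₂ refl)
... | end     | start   | end     = inj₂ (inj₁ refl)
... | end     | start   | other _ = contradiction ad (end≢other j μ)
... | end     | other _ | _       = contradiction ab (end≢other j μ)
... | other _ | start   | _       = contradiction (sym ab) (start≢other j μ)
... | other _ | end     | _       = contradiction (sym ab) (end≢other j μ)
... | other _ | other _ | start   = contradiction (sym ad) (start≢other j μ)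
... | other _ | other _ | end     = contradiction (sym ad) (end≢other j μ)
... | other a′ | other b′ | other d′ =
  Sum.map (cong (suc ∘ Fin.punchIn j)) (Sum.map (cong (suc ∘ Fin.punchIn j)) (cong (suc ∘ Fin.punchIn j)))
    (sameColour-atMostPairs n μ a′ b′ d′ (other-injective j μ ab) (other-injective j μ ad))

-- The matching can be read off: 0 is matched exactly when another vertex shares its colour,
-- `start-partner` identifies that vertex, and the rest follows by recursion.
sameColour-injective : ∀ n μ ν → (∀ a b → SameColour n μ a b → SameColour n ν a b) →
                       (∀ a b → SameColour n ν a b → SameColour n μ a b) → μ ≡ ν
sameColour-injective 0 _ _ _ _ = refl
sameColour-injective 1 _ _ _ _ = refl
sameColour-injective (suc (suc n)) (inj₁ μ) (inj₁ ν) μ⇒ν ν⇒μ = cong inj₁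
  (sameColour-injective (suc n) μ ν (λ a b → Fin.suc-injective ∘ μ⇒ν (suc a) (suc b) ∘ cong suc)
                                    (λ a b → Fin.suc-injective ∘ ν⇒μ (suc a) (suc b) ∘ cong suc))
sameColour-injective (suc (suc n)) (inj₁ μ) (inj₂ (j , ν)) _ ν⇒μ
  with () ← ν⇒μ zero (suc j) (sym (colour-end j ν))
sameColour-injective (suc (suc n)) (inj₂ (j , μ)) (inj₁ ν) μ⇒ν _
  with () ← μ⇒ν zero (suc j) (sym (colour-end j μ))
sameColour-injective (suc (suc n)) (inj₂ (j , μ)) (inj₂ (k , ν)) μ⇒ν ν⇒μ
  with refl ← start-partner k ν j (μ⇒ν zero (suc j) (sym (colour-end j μ))) =
  cong (λ ξ → inj₂ (j , ξ)) (sameColour-injective n μ ν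
    (λ a b → other-injective j ν ∘ μ⇒ν (suc (Fin.punchIn j a)) (suc (Fin.punchIn j b)) ∘ other-cong j μ)
    (λ a b → other-injective j μ ∘ ν⇒μ (suc (Fin.punchIn j a)) (suc (Fin.punchIn j b)) ∘ other-cong j ν))

-- A with-abstraction here would hide the descent from suc (suc n) to suc n; for the same
-- reason reflects-step takes its induction hypotheses as arguments.
byCases : {P B : Set} → Dec P → (P → B) → B → B
byCases (yes p) f _ = f p
byCases (no  _) _ b = b

-- The definition makes sense for any decidable relation. For a pairing, 0 has at most one partner,
-- so the choice of `j` loses nothing.
matchingOf : ∀ n {R : Fin n → Fin n → Set} → (∀ a b → Dec (R a b)) → Matching n
matchingOf 0             R? = tt
matchingOf 1             R? = tt
matchingOf (suc (suc n)) R? = byCases (Fin.any? (λ j → R? zero (suc j)))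
  (λ (j , _) → inj₂ (j , matchingOf n λ a b → R? (suc (Fin.punchIn j a)) (suc (Fin.punchIn j b))))
  (inj₁ (matchingOf (suc n) λ a b → R? (suc a) (suc b)))

-- These are equivalence relations with classes of at most two elements: given `R a b` and `R b d`,
-- two of `a`, `b`, `d` coincide, whence transitivity.
record Pairing {n : ℕ} (R : Fin n → Fin n → Set) : Set where
  field
    R-refl        : ∀ {a} → R a a
    R-sym         : ∀ {a b} → R a b → R b a
    R-atMostPairs : AtMostPairs R

restrict : ∀ {m n} {R : Fin n → Fin n → Set} (f : Fin m → Fin n) → (∀ {a b} → f a ≡ f b → a ≡ b) →
           Pairing R → Pairing (λ a b → R (f a) (f b))
restrict f f-injective P = record
  { R-refl        = R-refl
  ; R-sym         = R-sym
  ; R-atMostPairs = λ a b d ab ad → Sum.map f-injective (Sum.map f-injective f-injective)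
                      (R-atMostPairs (f a) (f b) (f d) ab ad)
  }
  where open Pairing P

-- The relations are quantified inside because the induction passes to their restrictions to fewer
-- vertices.
Reflects : ℕ → Set₁
Reflects n = {R S : Fin n → Fin n → Set} (R? : ∀ a b → Dec (R a b)) (S? : ∀ a b → Dec (S a b)) →
             Pairing R → Pairing S → matchingOf n R? ≡ matchingOf n S? → ∀ a b → R a b → S a b

reflects-step : ∀ {n} → Reflects (suc n) → Reflects n → Reflects (suc (suc n))
reflects-step {n} IH₁ IH₂ {R} {S} R? S? P Q eq a b Rab
  with Fin.any? (λ j → R? zero (suc j)) | Fin.any? (λ j → S? zero (suc j))
-- The mixed cases cannot occur, as `eq` would then identify `inj₁` with `inj₂`.
reflects-step {n} IH₁ IH₂ {R} {S} R? S? P Q eq a b Rab | no R∄ | no S∄ = skip a b Rab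
  where
  skip : ∀ a b → R a b → S a b
  skip zero    zero    _   = Pairing.R-refl Q
  skip zero    (suc b) R0b = contradiction (b , R0b) R∄
  skip (suc a) zero    Ra0 = contradiction (a , Pairing.R-sym P Ra0) R∄
  skip (suc a) (suc b) Rab = IH₁ _ _
    (restrict suc Fin.suc-injective P) (restrict suc Fin.suc-injective Q) (Sum.inj₁-injective eq) a b Rab
reflects-step {n} IH₁ IH₂ {R} {S} R? S? P Q eq a b Rab | yes (j , R0j) | yes (k , S0k)
  with refl ← cong proj₁ (Sum.inj₂-injective eq) = go (position j a) (position j b) Rab
  where
  keep : Fin n → Fin (suc (suc n))
  keep = suc ∘ Fin.punchIn j
  keep-injective : ∀ {a b} → keep a ≡ keep b → a ≡ b
  keep-injective = Fin.punchIn-injective j _ _ ∘ Fin.suc-injective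

  -- 0 and `suc j` already form a class of two, so neither is related to a third vertex.
  ¬start-other : ∀ {i} → ¬ R zero (keep i)
  ¬start-other {i} R0i with Pairing.R-atMostPairs P _ _ _ R0j R0i
  ... | inj₂ (inj₂ j≡i) = Fin.punchInᵢ≢i j i (sym (Fin.suc-injective j≡i))

  ¬end-other : ∀ {i} → ¬ R (suc j) (keep i)
  ¬end-other {i} Rji with Pairing.R-atMostPairs P _ _ _ (Pairing.R-sym P R0j) Rji
  ... | inj₂ (inj₁ j≡i) = Fin.punchInᵢ≢i j i (sym (Fin.suc-injective j≡i))

  go : ∀ {a b} → Position j a → Position j b → R a b → S a b
  go start     start     _   = Pairing.R-refl Q
  go start     end       _   = S0k
  go start     (other _) R0i = contradiction R0i ¬start-other
  go end       start     _   = Pairing.R-sym Q S0k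
  go end       end       _   = Pairing.R-refl Q
  go end       (other _) Rji = contradiction Rji ¬end-other
  go (other _) start     Ri0 = contradiction (Pairing.R-sym P Ri0) ¬start-other
  go (other _) end       Rij = contradiction (Pairing.R-sym P Rij) ¬end-other
  go (other i) (other l) Ril = IH₂ _ _ (restrict keep keep-injective P) (restrict keep keep-injective Q)
    (cong proj₂ (Sum.inj₂-injective eq)) i l Ril

matchingOf-reflects : ∀ n → Reflects n
matchingOf-reflects 1 R? S? P Q _ zero zero _ = Pairing.R-refl Q
matchingOf-reflects (suc (suc n)) = reflects-step (matchingOf-reflects (suc n)) (matchingOf-reflects n)

-- Upper and lower bounds for the three counts.

funToFin-cong : ∀ {m n} {f g : Fin m → Fin n} → f ≗ g → Fin.funToFin f ≡ Fin.funToFin g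
funToFin-cong {zero}  _   = refl
funToFin-cong {suc m} f≗g = cong₂ Fin.combine (f≗g zero) (funToFin-cong (f≗g ∘ suc))

finToFun-injective : ∀ m n (i j : Fin (n ^ m)) → Fin.finToFun {n} {m} i ≗ Fin.finToFun {n} {m} j → i ≡ j
finToFun-injective m n i j eq = trans (sym (Fin.funToFin-finToFin {m} {n} i))
  (trans (funToFin-cong {m} {n} eq) (Fin.funToFin-finToFin {m} {n} j))

funToFin-injective : ∀ {m n} {f g : Fin m → Fin n} → Fin.funToFin f ≡ Fin.funToFin g → f ≗ g
funToFin-injective {m} {n} {f} {g} eq i = trans (sym (Fin.finToFun-funToFin f i))
  (trans (cong (λ k → Fin.finToFun {n} {m} k i) eq) (Fin.finToFun-funToFin g i))

m[n,2]≤[1+n]^n : ∀ n → m n 2 ≤ suc n ^ n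
m[n,2]≤[1+n]^n n = Counting.count-≤ {n} (λ F → matroidOfRank? 2 (member? F))
  (λ F M → Fin.funToFin (RankTwo.classOf (member? F) M))
  λ {F} {G} M N eq →
    let same = funToFin-injective eq in
    RankTwo.parallel-determines (member? F) M (member? G) N
      (transfer F G M N same) (transfer G F N M (sym ∘ same))
  where
  transfer : ∀ F G M N → RankTwo.classOf (member? F) M ≗ RankTwo.classOf (member? G) N →
             ∀ a b → Parallel (Member F) a b → Parallel (Member G) a b
  -- Equal classes imply parallelism only when nonzero, as all loops share zero; here `ab`
  -- guarantees a nonzero class.
  transfer F G M N same a b ab =
    let _ , ca = RankTwo.classOf-nonzero (member? F) M ab
        cb = trans (sym (RankTwo.classOf-complete (member? F) M ab)) ca
    in RankTwo.classOf-sound (member? G) N (trans (sym (same a)) ca) (trans (sym (same b)) cb)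

s[n,2]≤#matchings : ∀ n → s n 2 ≤ #matchings n
s[n,2]≤#matchings n = Counting.count-≤ {n} (λ F → matroidOfRank? 2 (member? F) ×-dec sparsePaving? (member? F))
  (λ F (M , _) → Inverse.from (Fin↔Matching n) (matchingOf n (RankTwo.parallel? (member? F) M)))
  λ {F} {G} (M , SF) (N , SG) eq →
    let μ≡ν = Injection.injective (↔⇒↣ (↔-sym (Fin↔Matching n))) eq
    in RankTwo.parallel-determines (member? F) M (member? G) N
      (matchingOf-reflects n _ _ (pairing F M SF) (pairing G N SG) μ≡ν)
      (matchingOf-reflects n _ _ (pairing G N SG) (pairing F M SF) (sym μ≡ν))
  where
  pairing : ∀ F → MatroidOfRank 2 (Member F) → SparsePaving (Member F) → Pairing (Parallel (Member F))
  pairing F M S = record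
    { R-refl        = parallel-refl (loopless S _)
    ; R-sym         = parallel-sym
    ; R-atMostPairs = parallel-classes≤2 S
    }
    where open RankTwo (member? F) M

-- By contraposition: a pair with two `d`-colours is rainbow for `d`, hence for `c`, so its
-- `c`-colours differ. Thus the independent sets determine the colour classes.
rainbow-reflects : ∀ {n} {C D : Set} (_≟ᶜ_ : DecidableEquality C) (_≟ᵈ_ : DecidableEquality D)
                   (c : Fin n → C) (d : Fin n → D) →
                   (∀ A → Rainbow.RainbowSet _≟ᵈ_ d A → Rainbow.RainbowSet _≟ᶜ_ c A) →
                   ∀ a b → c a ≡ c b → d a ≡ d b
rainbow-reflects _≟ᶜ_ _≟ᵈ_ c d d⇒c a b ca≡cb = decidable-stable (d a ≟ᵈ d b) λ da≢db →
  da≢db (cong d (proj₂ (d⇒c (pair a b) (Rainbow.pair-rainbow _≟ᵈ_ d da≢db)) a b (a∈pair a b) (b∈pair a b) ca≡cb))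

-- Three vertices cannot share a colour. For `n` equal to 2 the matched pair would yield a matroid
-- of rank one, whence the bound `3 ≤ n`.
two-colours : ∀ n μ → 3 ≤ n → ∃ λ a → ∃ λ b → colour n μ a ≢ colour n μ b
two-colours n@(suc (suc (suc _))) μ _
  with colour n μ zero Fin.≟ colour n μ (suc zero) | colour n μ zero Fin.≟ colour n μ (suc (suc zero))
... | no 0≢1 | _      = _ , _ , 0≢1
... | yes _  | no 0≢2 = _ , _ , 0≢2
... | yes eq₁ | yes eq₂ with sameColour-atMostPairs n μ zero (suc zero) (suc (suc zero)) eq₁ eq₂
...   | inj₂ (inj₁ ())
two-colours (suc (suc zero)) _ (s≤s (s≤s ()))
two-colours (suc zero) _ (s≤s ())

#matchings≤s[n,2] : ∀ n → 3 ≤ n → #matchings n ≤ s n 2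
#matchings≤s[n,2] n 3≤n = Counting.≤-count {n}
  (λ F → matroidOfRank? 2 (member? F) ×-dec sparsePaving? (member? F))
  (λ i → Rainbow.rainbow? Fin._≟_ (c i))
  (λ i F sound complete → let open Rainbow Fin._≟_ (c i)
                              _ , _ , ca≢cb = two-colours n (to i) 3≤n in
    matroidOfRank2 sound complete ca≢cb , paving sound complete ca≢cb ,
    dual-paving sound complete ca≢cb (sameColour-atMostPairs n (to i)))
  (λ i j i⇒j j⇒i → Injection.injective (↔⇒↣ (Fin↔Matching n)) (sameColour-injective n (to i) (to j)
    (rainbow-reflects Fin._≟_ Fin._≟_ (c i) (c j) j⇒i) (rainbow-reflects Fin._≟_ Fin._≟_ (c j) (c i) i⇒j)))
  where
  to : Fin (#matchings n) → Matching n
  to = Inverse.to (Fin↔Matching n)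
  c : Fin (#matchings n) → Fin n → Fin n
  c i = colour n (to i)

k^l≤p[k+l,2] : ∀ k l {x y : Fin k} → x ≢ y → k ^ l ≤ p (k + l) 2
k^l≤p[k+l,2] k l {x} {y} x≢y = Counting.≤-count {k + l}
  (λ F → matroidOfRank? 2 (member? F) ×-dec paving? (member? F))
  (λ i → Rainbow.rainbow? Fin._≟_ (c i))
  (λ i F sound complete → let open Rainbow Fin._≟_ (c i) in
    matroidOfRank2 sound complete (distinct i) , paving sound complete (distinct i))
  -- Under `c i`, the vertex `k ↑ʳ x` shares its colour with vertex `word i x` among the first `k`.
  -- The same holds under `c j`, where these vertices have colours `word j x` and `word i x`.
  (λ i j i⇒j j⇒i → finToFun-injective l k i j λ x →
    sym (trans (sym (c-right j x)) (trans (sym (rainbow-reflects Fin._≟_ Fin._≟_ (c i) (c j) j⇒i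
      (word i x Fin.↑ˡ l) (k Fin.↑ʳ x) (trans (c-left i _) (sym (c-right i x))))) (c-left j _))))
  where
  word : Fin (k ^ l) → Fin l → Fin k
  word = Fin.finToFun
  c : Fin (k ^ l) → Fin (k + l) → Fin k
  c i = [ id , word i ]′ ∘ Fin.splitAt k
  c-left : ∀ i x → c i (x Fin.↑ˡ l) ≡ x
  c-left i x = cong [ id , word i ]′ (Fin.splitAt-↑ˡ k x l)
  c-right : ∀ i x → c i (k Fin.↑ʳ x) ≡ word i x
  c-right i x = cong [ id , word i ]′ (Fin.splitAt-↑ʳ k l x)
  distinct : ∀ i → c i (x Fin.↑ˡ l) ≢ c i (y Fin.↑ˡ l)
  distinct i eq = x≢y (trans (sym (c-left i x)) (trans eq (c-left i y)))

length-filter-mono : ∀ {A : Set} {P Q : Pred A 0ℓ} (P? : Decidable P) (Q? : Decidable Q) →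
                     (∀ {x} → P x → Q x) → ∀ xs → length (filter P? xs) ≤ length (filter Q? xs)
length-filter-mono P? Q? P⇒Q []       = z≤n
length-filter-mono P? Q? P⇒Q (x ∷ xs) with P? x | Q? x
... | yes Px | yes _  = s≤s (length-filter-mono P? Q? P⇒Q xs)
... | yes Px | no ¬Qx = contradiction (P⇒Q Px) ¬Qx
... | no _   | yes _  = ℕ.m≤n⇒m≤1+n (length-filter-mono P? Q? P⇒Q xs)
... | no _   | no _   = length-filter-mono P? Q? P⇒Q xs

p≤m : ∀ n r → p n r ≤ m n r
p≤m n r = length-filter-mono _ _ proj₁ (families n)

-- Estimates

#matchings-step : ∀ n → #matchings n ≤ #matchings (suc n)
#matchings-step zero    = ℕ.≤-refl
#matchings-step (suc n) = ℕ.m≤m+n _ _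

-- Monotonicity in the recurrence gives `t (n + 2) ≥ (n + 2) * t n`, so the square gains at least
-- the factor `(n + 2) * (n + 1)` gained by the factorial.
n!≤#matchings² : ∀ n → n ! ≤ #matchings n ^ 2
n!≤#matchings² 0 = ℕ.≤-refl
n!≤#matchings² 1 = ℕ.≤-refl
n!≤#matchings² (suc (suc n)) = begin
  suc (suc n) * (suc n * n !)         ≤⟨ ℕ.*-monoʳ-≤ (suc (suc n)) (ℕ.*-mono-≤ (ℕ.n≤1+n (suc n)) (n!≤#matchings² n)) ⟩
  suc (suc n) * (suc (suc n) * t ^ 2) ≡⟨ square-* (suc (suc n)) t ⟩
  (suc (suc n) * t) ^ 2               ≤⟨ ℕ.^-monoˡ-≤ 2 (ℕ.+-monoˡ-≤ (suc n * t) (#matchings-step n)) ⟩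
  #matchings (suc (suc n)) ^ 2        ∎
  where
  open ℕ.≤-Reasoning
  t : ℕ
  t = #matchings n
  square-* : ∀ x y → x * (x * (y * (y * 1))) ≡ x * y * (x * y * 1)
  square-* = solve-∀

-- The slack is the squared difference; ordering `a` and `b` expresses it without subtraction, as
-- `d * d`.
[a+b]²≤2[a²+b²] : ∀ a b → (a + b) ^ 2 ≤ 2 * (a ^ 2 + b ^ 2)
[a+b]²≤2[a²+b²] a b with ℕ.≤-total a b
... | inj₁ a≤b = subst (λ b → (a + b) ^ 2 ≤ 2 * (a ^ 2 + b ^ 2)) (ℕ.m+[n∸m]≡n a≤b)
      (ℕ.m+n≤o⇒m≤o _ (ℕ.≤-reflexive (identity a (b ∸ a))))
  where
  identity : ∀ a d → (a + (a + d)) * ((a + (a + d)) * 1) + d * d ≡ 2 * (a * (a * 1) + (a + d) * ((a + d) * 1))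
  identity = solve-∀
... | inj₂ b≤a = subst (λ a → (a + b) ^ 2 ≤ 2 * (a ^ 2 + b ^ 2)) (ℕ.m+[n∸m]≡n b≤a)
      (ℕ.m+n≤o⇒m≤o _ (ℕ.≤-reflexive (identity b (a ∸ b))))
  where
  identity : ∀ b d → (b + d + b) * ((b + d + b) * 1) + d * d ≡ 2 * ((b + d) * ((b + d) * 1) + b * (b * 1))
  identity = solve-∀

#matchings²≤ : ∀ n → #matchings n ^ 2 ≤ (4 * suc n) ^ n
#matchings²≤ 0 = ℕ.≤-refl
#matchings²≤ 1 = s≤s z≤n
#matchings²≤ (suc (suc n)) = begin
  (t₁ + suc n * t₀) ^ 2                      ≤⟨ [a+b]²≤2[a²+b²] t₁ (suc n * t₀) ⟩
  2 * (t₁ ^ 2 + (suc n * t₀) ^ 2)            ≡⟨ cong (λ z → 2 * (t₁ ^ 2 + z)) (square-* (suc n) t₀) ⟩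
  2 * (t₁ ^ 2 + suc n ^ 2 * t₀ ^ 2)          ≤⟨ ℕ.*-monoʳ-≤ 2 (ℕ.+-mono-≤ (ℕ.≤-trans (#matchings²≤ (suc n)) widen₁)
                                                  (ℕ.*-monoʳ-≤ (suc n ^ 2) (ℕ.≤-trans (#matchings²≤ n) widen₀))) ⟩
  2 * (x * x ^ n + suc n ^ 2 * x ^ n)        ≤⟨ ℕ.m+n≤o⇒m≤o _ (ℕ.≤-reflexive (identity n (x ^ n))) ⟩
  x * (x * x ^ n)                            ∎
  where
  open ℕ.≤-Reasoning
  t₀ t₁ x : ℕ
  t₀ = #matchings n
  t₁ = #matchings (suc n)
  x = 4 * suc (suc (suc n))
  widen₁ : (4 * suc (suc n)) ^ suc n ≤ x ^ suc n
  widen₁ = ℕ.^-monoˡ-≤ (suc n) (ℕ.*-monoʳ-≤ 4 (ℕ.n≤1+n (suc (suc n))))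
  widen₀ : (4 * suc n) ^ n ≤ x ^ n
  widen₀ = ℕ.^-monoˡ-≤ n (ℕ.*-monoʳ-≤ 4 (ℕ.m≤n+m (suc n) 2))
  square-* : ∀ x y → x * y * (x * y * 1) ≡ x * (x * 1) * (y * (y * 1))
  square-* = solve-∀
  -- With `x = 4 * (n + 3)`, the quadratic is `x² - 2x - 2(n + 1)²`; the factor 4 in the bound makes
  -- it positive.
  identity : ∀ n y → 2 * (4 * suc (suc (suc n)) * y + suc n * (suc n * 1) * y) + (14 * n * n + 84 * n + 118) * y
             ≡ 4 * suc (suc (suc n)) * (4 * suc (suc (suc n)) * y)
  identity = solve-∀

-- The top `l` factors of the factorial all exceed `k`.
k^l≤[k+l]! : ∀ k l → k ^ l ≤ (k + l) !
k^l≤[k+l]! k zero    = ℕ.1≤n! (k + 0)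
k^l≤[k+l]! k (suc l) = subst (λ n → k ^ suc l ≤ n !) (sym (ℕ.+-suc k l))
  (ℕ.*-mono-≤ (ℕ.m≤n⇒m≤1+n (ℕ.m≤m+n k l)) (k^l≤[k+l]! k l))

-- Choice of the scale.

binary-magnitude : ∀ n .{{_ : ℕ.NonZero n}} → ∃ λ e → 2 ^ e ≤ n × n < 2 ^ suc e
binary-magnitude (suc zero)    = 0 , ℕ.≤-refl , ℕ.≤-refl
binary-magnitude (suc n@(suc _)) with binary-magnitude n
... | e , 2^e≤n , n<2^[1+e] with suc n ℕ.<? 2 ^ suc e
...   | yes 1+n< = e , ℕ.m≤n⇒m≤1+n 2^e≤n , 1+n<
...   | no  1+n≮ = suc e , ℕ.≮⇒≥ 1+n≮ , ℕ.≤-<-trans n<2^[1+e]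
  (ℕ.^-monoʳ-< 2 (ℕ.n<1+n 1) (ℕ.n<1+n (suc e)))

-- With k = 2 ^ suc g, both k ^ l and (4 * suc n) ^ n have binary logarithm between
-- g * l and (3 + h) * n, whose ratio is at most 1 + 1 / K.
record Scale (K n : ℕ) : Set where
  field
    h g l : ℕ
    n≡    : 2 ^ suc g + l ≡ n
    g>0   : 0 < g
    l>0   : 0 < l
    n<2^  : n < 2 ^ h
    ratio : K * ((3 + h) * n) ≤ suc K * (g * l)

-- For c = 2 * suc K, the summand c in the exponent gives c * k ≤ n, and the other one
-- gives g ≥ 2 * K * (c + 5); together these yield the ratio in Scale.
threshold : ℕ → ℕ
threshold K = 2 ^ (suc (2 * K * (2 * suc K + 5)) + 2 * suc K)

scale : ∀ K n → .{{_ : ℕ.NonZero K}} → threshold K ≤ n → Scale K n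
scale K n N≤n = record
  { h     = suc e
  ; g     = g
  ; l     = l
  ; n≡    = k+l≡n
  ; g>0   = g>0
  ; l>0   = l>0
  ; n<2^  = n<2^[1+e]
  ; ratio = ℕ.*-cancelˡ-≤ 2 ratio
  }
  where
  open ℕ.≤-Reasoning
  c f₀ : ℕ
  c = 2 * suc K
  f₀ = 2 * K * (c + 5)
  0<n : 0 < n
  0<n = ℕ.≤-trans (ℕ.m^n>0 2 (suc f₀ + c)) N≤n
  magnitude : ∃ λ e → 2 ^ e ≤ n × n < 2 ^ suc e
  magnitude = binary-magnitude n {{ℕ.>-nonZero 0<n}}
  e : ℕ
  e = proj₁ magnitude
  n<2^[1+e] : n < 2 ^ suc e
  n<2^[1+e] = proj₂ (proj₂ magnitude)
  f₀+c<e+1 : suc f₀ + c < suc e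
  f₀+c<e+1 = ℕ.≰⇒> λ e<f₀+c → ℕ.<⇒≱ (ℕ.≤-<-trans N≤n n<2^[1+e]) (ℕ.^-monoʳ-≤ 2 e<f₀+c)
  g : ℕ
  -- This makes `suc g + c` equal to `e`, so `2 ^ c` copies of `2 ^ suc g` give `2 ^ e`, which is at
  -- most `n`.
  g = e ∸ suc c
  f₀≤g : f₀ ≤ g
  f₀≤g = ℕ.m+n≤o⇒m≤o∸n f₀ (subst (_≤ e) (sym (ℕ.+-suc f₀ c)) (ℕ.≤-pred f₀+c<e+1))
  e≡ : suc g + c ≡ e
  e≡ = trans (sym (ℕ.+-suc g c)) (ℕ.m∸n+n≡m (ℕ.≤-trans (ℕ.s≤s (ℕ.m≤n+m c f₀)) (ℕ.≤-pred f₀+c<e+1)))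
  g>0 : 0 < g
  g>0 = ℕ.<-≤-trans (ℕ.*-mono-≤ (ℕ.>-nonZero⁻¹ (2 * K) {{ℕ.m*n≢0 2 K}}) (ℕ.≤-trans (s≤s z≤n) (ℕ.m≤n+m 5 c))) f₀≤g
  k : ℕ
  k = 2 ^ suc g
  ck≤n : c * k ≤ n
  ck≤n = begin
    c * k                ≤⟨ ℕ.*-monoˡ-≤ k (ℕ.<⇒≤ (LogLemmas.n<2^n c)) ⟩
    2 ^ c * k            ≡⟨ ℕ.*-comm (2 ^ c) k ⟩
    k * 2 ^ c            ≡⟨ ℕ.^-distribˡ-+-* 2 (suc g) c ⟨
    2 ^ (suc g + c)      ≡⟨ cong (2 ^_) e≡ ⟩
    2 ^ e                ≤⟨ proj₁ (proj₂ magnitude) ⟩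
    n                    ∎
  k≤n : k ≤ n
  k≤n = ℕ.≤-trans (ℕ.m≤n*m k c) ck≤n
  l : ℕ
  l = n ∸ k
  k+l≡n : k + l ≡ n
  k+l≡n = ℕ.m+[n∸m]≡n k≤n
  -- `c * l` is `c * n` minus `c * k`; the subtracted term costs at most `n`, and `c` is
  -- `2 * K + 2`.
  [2K+1]n≤cl : (2 * K + 1) * n ≤ c * l
  [2K+1]n≤cl = ℕ.+-cancelˡ-≤ n _ _ (begin
    n + (2 * K + 1) * n   ≡⟨ identity K n ⟩
    c * n                 ≡⟨ cong (c *_) k+l≡n ⟨
    c * (k + l)           ≡⟨ ℕ.*-distribˡ-+ c k l ⟩
    c * k + c * l         ≤⟨ ℕ.+-monoˡ-≤ (c * l) ck≤n ⟩
    n + c * l             ∎)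
    where
    identity : ∀ K n → n + (2 * K + 1) * n ≡ 2 * suc K * n
    identity = solve-∀
  l>0 : 0 < l
  l>0 = ℕ.n≢0⇒n>0 λ l≡0 → ℕ.<⇒≱ 0<n (begin
    n                 ≤⟨ ℕ.m≤n*m n (2 * K + 1) {{ℕ.>-nonZero (ℕ.m≤n+m 1 (2 * K))}} ⟩
    (2 * K + 1) * n   ≤⟨ [2K+1]n≤cl ⟩
    c * l             ≡⟨ cong (c *_) l≡0 ⟩
    c * 0             ≡⟨ ℕ.*-zeroʳ c ⟩
    0                 ∎)
  -- Both sides are doubled so that `c = 2 * suc K` appears. The left factor is
  -- `2 * K * (g + c + 5)`, whose constant part is `f₀`, at most `g`.
  ratio : 2 * (K * ((3 + suc e) * n)) ≤ 2 * (suc K * (g * l))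
  ratio = begin
    2 * (K * ((3 + suc e) * n))           ≡⟨ cong (λ e → 2 * (K * ((3 + suc e) * n))) e≡ ⟨
    2 * (K * ((3 + suc (suc g + c)) * n)) ≡⟨ regroup K g c n ⟩
    (2 * K * g + 2 * K * (c + 5)) * n     ≤⟨ ℕ.*-monoˡ-≤ n (ℕ.+-monoʳ-≤ (2 * K * g) f₀≤g) ⟩
    (2 * K * g + g) * n                   ≡⟨ factor K g n ⟩
    g * ((2 * K + 1) * n)                 ≤⟨ ℕ.*-monoʳ-≤ g [2K+1]n≤cl ⟩
    g * (2 * suc K * l)                   ≡⟨ commute K g l ⟩
    2 * (suc K * (g * l))                 ∎
    where
    regroup : ∀ K g c n → 2 * (K * ((3 + suc (suc g + c)) * n)) ≡ (2 * K * g + 2 * K * (c + 5)) * n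
    regroup = solve-∀
    factor : ∀ K g n → (2 * K * g + g) * n ≡ g * ((2 * K + 1) * n)
    factor = solve-∀
    commute : ∀ K g l → g * (2 * suc K * l) ≡ 2 * (suc K * (g * l))
    commute = solve-∀

module _ {K n : ℕ} (S : Scale K n) where
  open Scale S

  -- Taking `suc g` in `k` but `g` in the exponent leaves room for the strictness that cuts require.
  -- The exponent `3 + h` does the same above, where `2 + h` would give a weak bound.
  2^gl< : ∀ {N} → (2 ^ suc g) ^ l ≤ N → 2 ^ (g * l) < N
  2^gl< {N} le = begin-strict
    2 ^ (g * l)      <⟨ ℕ.^-monoʳ-< 2 (ℕ.n<1+n 1) (ℕ.*-monoˡ-< l {{ℕ.>-nonZero l>0}} (ℕ.n<1+n g)) ⟩
    2 ^ (suc g * l)  ≡⟨ ℕ.^-*-assoc 2 (suc g) l ⟨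
    (2 ^ suc g) ^ l  ≤⟨ le ⟩
    N                ∎
    where open ℕ.≤-Reasoning

  0<n : 0 < n
  0<n = subst (0 <_) n≡ (ℕ.≤-trans l>0 (ℕ.m≤n+m l _))

  <2^[3+h]n : ∀ {N} → N ≤ (4 * suc n) ^ n → N < 2 ^ ((3 + h) * n)
  <2^[3+h]n {N} le = begin-strict
    N                      ≤⟨ le ⟩
    (4 * suc n) ^ n        ≤⟨ ℕ.^-monoˡ-≤ n (ℕ.*-monoʳ-≤ 4 n<2^) ⟩
    (4 * 2 ^ h) ^ n        ≡⟨ cong (_^ n) (ℕ.^-distribˡ-+-* 2 2 h) ⟨
    (2 ^ (2 + h)) ^ n      ≡⟨ ℕ.^-*-assoc 2 (2 + h) n ⟩
    2 ^ ((2 + h) * n)      <⟨ ℕ.^-monoʳ-< 2 (ℕ.n<1+n 1) (ℕ.*-monoˡ-< n {{ℕ.>-nonZero 0<n}} (ℕ.n<1+n (2 + h))) ⟩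
    2 ^ ((3 + h) * n)      ∎
    where open ℕ.≤-Reasoning

-- Quotients of logarithms

nat : ℕ → ℚᵘ
nat n = mkℚᵘ (+ n) 0

nat-mono-≤ : ∀ {a b} → a ≤ b → nat a ℚ.≤ nat b
nat-mono-≤ {a} {b} a≤b = *≤* (subst₂ ℤ._≤_ (sym (ℤ.*-identityʳ (+ a))) (sym (ℤ.*-identityʳ (+ b))) (ℤ.+≤+ a≤b))

nat-mono-< : ∀ {a b} → a < b → nat a ℚ.< nat b
nat-mono-< {a} {b} a<b = *<* (subst₂ ℤ._<_ (sym (ℤ.*-identityʳ (+ a))) (sym (ℤ.*-identityʳ (+ b))) (ℤ.+<+ a<b))

nat-+ : ∀ a b → nat (a + b) ℚ.≃ nat a ℚ.+ nat b
nat-+ a b = *≡* (cong (ℤ._* + 1) (cong₂ ℤ._+_ (sym (ℤ.*-identityʳ (+ a))) (sym (ℤ.*-identityʳ (+ b)))))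

nat-* : ∀ a b → nat (a * b) ℚ.≃ nat a ℚ.* nat b
nat-* a b = *≡* (cong (ℤ._* + 1) (ℤ.pos-* a b))

module _ {a b d e : ℕ} (0<a : 0 < a) (ratio : suc d * b ≤ suc (suc d) * a) where
  private
    ε A B k : ℚᵘ
    ε = mkℚᵘ (+ suc e) d
    A = nat a
    B = nat b
    k = nat (suc d)

    0≤A : ℚ.NonNegative A
    0≤A = ℚ.nonNegative (nat-mono-≤ {0} {a} z≤n)

    1≤εk : 1ℚᵘ ℚ.≤ ε ℚ.* k
    1≤εk = *≤* (ℤ.+≤+ (ℕ.≤-trans (ℕ.≤-reflexive (ℕ.*-identityˡ (suc (d * 1))))
      (ℕ.*-monoˡ-≤ 1 (ℕ.m≤n*m (suc d) (suc e)))))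

  -- Here `ε` is at least `1 / suc d`, so `ratio` bounds `b / a` by `1 + 1 / suc d` and hence by
  -- `1 + ε`. The proof clears the denominator by multiplying with `k`.
  b≤[1+ε]a : B ℚ.≤ (1ℚᵘ ℚ.+ ε) ℚ.* A
  b≤[1+ε]a = ℚ.*-cancelʳ-≤-pos k (begin
    B ℚ.* k                     ≃⟨ ℚ.*-comm B k ⟩
    k ℚ.* B                     ≃⟨ nat-* (suc d) b ⟨
    nat (suc d * b)             ≤⟨ nat-mono-≤ ratio ⟩
    nat (a + suc d * a)         ≃⟨ nat-+ a (suc d * a) ⟩
    A ℚ.+ nat (suc d * a)       ≃⟨ ℚ.+-congʳ A (nat-* (suc d) a) ⟩
    A ℚ.+ k ℚ.* A               ≃⟨ ℚ.+-congˡ (k ℚ.* A) (ℚ.≃-sym (ℚ.*-identityˡ A)) ⟩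
    1ℚᵘ ℚ.* A ℚ.+ k ℚ.* A       ≤⟨ ℚ.+-monoˡ-≤ (k ℚ.* A) (ℚ.*-monoˡ-≤-nonNeg A {{0≤A}} 1≤εk) ⟩
    ε ℚ.* k ℚ.* A ℚ.+ k ℚ.* A   ≃⟨ factor ε k A ⟩
    (1ℚᵘ ℚ.+ ε) ℚ.* A ℚ.* k     ∎)
    where
    open ℚ.≤-Reasoning
    open +-*-Solver
    factor : ∀ ε k A → ε ℚ.* k ℚ.* A ℚ.+ k ℚ.* A ℚ.≃ (1ℚᵘ ℚ.+ ε) ℚ.* A ℚ.* k
    factor = solve 3 (λ ε k A → ε :* k :* A :+ k :* A := (con 1ℚᵘ :+ ε) :* A :* k) ℚ.≃-refl

  [1-ε]b≤a : A ℚ.≤ B → (1ℚᵘ ℚ.- ε) ℚ.* B ℚ.≤ A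
  [1-ε]b≤a A≤B = begin
    (1ℚᵘ ℚ.- ε) ℚ.* B                            ≃⟨ expand ε B ⟩
    B ℚ.- ε ℚ.* B                                ≤⟨ ℚ.+-mono-≤ b≤[1+ε]a (ℚ.neg-mono-≤ (ℚ.*-monoʳ-≤-nonNeg ε A≤B)) ⟩
    (1ℚᵘ ℚ.+ ε) ℚ.* A ℚ.- ε ℚ.* A                ≃⟨ collapse ε A ⟩
    A                                            ∎
    where
    open ℚ.≤-Reasoning
    open +-*-Solver
    expand : ∀ ε B → (1ℚᵘ ℚ.- ε) ℚ.* B ℚ.≃ B ℚ.- ε ℚ.* B
    expand = solve 2 (λ ε B → (con 1ℚᵘ :+ :- ε) :* B := B :+ :- (ε :* B)) ℚ.≃-refl
    collapse : ∀ ε A → (1ℚᵘ ℚ.+ ε) ℚ.* A ℚ.- ε ℚ.* A ℚ.≃ A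
    collapse = solve 2 (λ ε A → (con 1ℚᵘ :+ ε) :* A :+ :- (ε :* A) := A) ℚ.≃-refl

  [1-ε]a≤a : (1ℚᵘ ℚ.- ε) ℚ.* A ℚ.≤ A
  [1-ε]a≤a = begin
    (1ℚᵘ ℚ.- ε) ℚ.* A   ≤⟨ ℚ.*-monoˡ-≤-nonNeg A {{0≤A}} (ℚ.+-monoʳ-≤ 1ℚᵘ (ℚ.neg-mono-≤ (ℚ.nonNegative⁻¹ ε))) ⟩
    1ℚᵘ ℚ.* A           ≃⟨ ℚ.*-identityˡ A ⟩
    A                   ∎
    where open ℚ.≤-Reasoning

Between : ℕ → ℕ → ℝ → Set
Between a b x = nat a <ʳ x × x ʳ< nat b

-- `a` and `b` serve as the rational bounds on `g n` in the quotient cut, which asks for an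
-- inequality at each of them. As `f n` lies in the same interval, all four reduce to comparisons of
-- `a` and `b`.
sandwich⇒∼ : (f g : ℕ → ℝ) →
             (∀ K .{{_ : ℕ.NonZero K}} → ∃ λ N → ∀ n → N ≤ n → ∃ λ a → ∃ λ b →
               0 < a × K * b ≤ suc K * a × Between a b (f n) × Between a b (g n)) →
             f ∼ g
sandwich⇒∼ f g sandwich (mkℚᵘ (+ zero) d) (*<* (ℤ.+<+ ()))
-- `K` is the denominator of `ε`, so `1 / K` is at most `ε`.
sandwich⇒∼ f g sandwich ε@(mkℚᵘ (+ suc e) d) 0<ε with sandwich (suc d)
... | N , large = N , λ n N≤n →
  let a , b , 0<a , ratio , (a<f , f<b) , (a<g , g<b) = large n N≤n
      0<A = nat-mono-< 0<a
      A≤B = ℚ.<⇒≤ (ℝ.lower<upper (g n) a<g g<b)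
      B≤ = b≤[1+ε]a {a} {b} {d} {e} 0<a ratio
      ≤A = [1-ε]b≤a {a} {b} {d} {e} 0<a ratio A≤B
  in ℝ.lower-closed (g n) 0<A a<g ,
     (nat a , nat b , 0<A , a<g , g<b ,
       ℝ.lower-≤ (f n) ([1-ε]a≤a {a} {b} {d} {e} 0<a ratio) a<f ,
       ℝ.lower-≤ (f n) ≤A a<f) ,
     (nat a , nat b , 0<A , a<g , g<b ,
       ℝ.upper-≤ (f n) B≤ f<b ,
       ℝ.upper-≤ (f n) (ℚ.≤-trans B≤ (ℚ.*-monoʳ-≤-nonNeg (1ℚᵘ ℚ.+ ε) A≤B)) f<b)
sandwich⇒∼ f g sandwich (mkℚᵘ -[1+ _ ] _) (*<* ())

log-between : ∀ a b {N} → 2 ^ a < N → N < 2 ^ b → Between a b (log₂ N)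
log-between _ _ {zero}  ()
log-between a b {suc N} below above =
  subst (2 ^ a <_) (sym (ℕ.^-identityʳ (suc N))) below ,
  subst (_< 2 ^ b) (sym (ℕ.^-identityʳ (suc N))) above

-- The double of a cut is tested at half the rational; writing that half with denominator 2 turns
-- the logarithm's cut into the comparison of `2 ^ a` with `N ^ 2`. The dummy logarithm of 0 is
-- excluded by the lower bound.
2log-between : ∀ a b {N} → 2 ^ a < N ^ 2 → N ^ 2 < 2 ^ b → Between a b (2 · log₂ N)
2log-between _ _ {zero}  ()
2log-between a b {suc N} below above =
  ℝ.lower-≤ (log₂ (suc N)) {r = mkℚᵘ (+ a) 1} (ℚ.≤-reflexive (half a)) below ,
  ℝ.upper-≤ (log₂ (suc N)) {q = mkℚᵘ (+ b) 1} (ℚ.≤-reflexive (ℚ.≃-sym (half b))) above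
  where
  half : ∀ c → nat c ℚ.* (+ 1 ℚ./ 2) ℚ.≃ mkℚᵘ (+ c) 1
  half c = *≡* (cong (ℤ._* + 2) (ℤ.*-identityʳ (+ c)))

-- A common interval for the three logarithms, and the asymptotics.

record Rank2Bounds (K n : ℕ) : Set where
  field
    a b         : ℕ
    a>0         : 0 < a
    ratio       : K * b ≤ suc K * a
    2logs-bound : Between a b (2 · log₂ (s n 2))
    logp-bound  : Between a b (log₂ (p n 2))
    logm-bound  : Between a b (log₂ (m n 2))

rank2-bounds : ∀ K n → 3 ≤ n → Scale K n → Rank2Bounds K n
rank2-bounds K n 3≤n S = record
  { a           = g * l
  ; b           = (3 + h) * n
  ; a>0         = ℕ.*-mono-≤ g>0 l>0
  ; ratio       = ratio
  ; 2logs-bound = 2log-between (g * l) ((3 + h) * n) {s n 2}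
      (2^gl< S (ℕ.≤-trans k^l≤n! (ℕ.≤-trans (n!≤#matchings² n) (ℕ.^-monoˡ-≤ 2 (#matchings≤s[n,2] n 3≤n)))))
      (<2^[3+h]n S (ℕ.≤-trans (ℕ.^-monoˡ-≤ 2 (s[n,2]≤#matchings n)) (#matchings²≤ n)))
  ; logp-bound  = log-between (g * l) ((3 + h) * n)
      (2^gl< S k^l≤p) (<2^[3+h]n S (ℕ.≤-trans (p≤m n 2) m≤))
  ; logm-bound  = log-between (g * l) ((3 + h) * n)
      (2^gl< S (ℕ.≤-trans k^l≤p (p≤m n 2))) (<2^[3+h]n S m≤)
  }
  where
  open Scale S
  k^l≤n! : (2 ^ suc g) ^ l ≤ n !
  k^l≤n! = subst (λ n → (2 ^ suc g) ^ l ≤ n !) n≡ (k^l≤[k+l]! (2 ^ suc g) l)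
  -- Two of the first `k` elements must differ for the matroids to have rank two; 0 and 1 are used.
  1<k : 1 < 2 ^ suc g
  1<k = ℕ.^-monoʳ-< 2 (ℕ.n<1+n 1) (s≤s {n = g} z≤n)
  k^l≤p : (2 ^ suc g) ^ l ≤ p n 2
  k^l≤p = subst (λ n → (2 ^ suc g) ^ l ≤ p n 2) n≡
    (k^l≤p[k+l,2] (2 ^ suc g) l {Fin.fromℕ< (ℕ.<⇒≤ 1<k)} {Fin.fromℕ< 1<k} λ eq →
      ℕ.0≢1+n (trans (sym (Fin.toℕ-fromℕ< (ℕ.<⇒≤ 1<k))) (trans (cong Fin.toℕ eq) (Fin.toℕ-fromℕ< 1<k))))
  m≤ : m n 2 ≤ (4 * suc n) ^ n
  m≤ = ℕ.≤-trans (m[n,2]≤[1+n]^n n) (ℕ.^-monoˡ-≤ n (ℕ.m≤n*m (suc n) 4))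

theorem1p1 : ((λ n → 2 · log₂ (s n 2)) ∼ (λ n → log₂ (p n 2))) ×
    ((λ n → log₂ (p n 2)) ∼ (λ n → log₂ (m n 2)))
theorem1p1 =
  sandwich⇒∼ 2logs logp (λ K → threshold K + 3 , λ n N≤n → let open Rank2Bounds (bounds K n N≤n) in
    a , b , a>0 , ratio , 2logs-bound , logp-bound) ,
  sandwich⇒∼ logp logm (λ K → threshold K + 3 , λ n N≤n → let open Rank2Bounds (bounds K n N≤n) in
    a , b , a>0 , ratio , logp-bound , logm-bound)
  where
  2logs logp logm : ℕ → ℝ
  2logs n = 2 · log₂ (s n 2)
  logp n = log₂ (p n 2)
  logm n = log₂ (m n 2)
  -- The summand 3 supplies `3 ≤ n` for the matching bound.
  bounds : ∀ K n .{{_ : ℕ.NonZero K}} → threshold K + 3 ≤ n → Rank2Bounds K n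
  bounds K n N≤n = rank2-bounds K n (ℕ.m+n≤o⇒n≤o (threshold K) N≤n)
    (scale K n (ℕ.m+n≤o⇒m≤o (threshold K) N≤n))
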